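{- The commutative monoids $(\mathcal{A},+)$, $(\mathcal{M},\cdot)$ and $(\mathcal{I}_0,\cdot)$ are pairwise isomorphic, via bijections that respect the binary operations and that carry the additive functional equation $f(xy)=f(x)+f(y)$ (for coprime $x,y$) of elements of $\mathcal{A}$ to the multiplicative functional equation $g(xy)=g(x)g(y)$ (for coprime $x,y$) of elements of $\mathcal{M}$ and $\mathcal{I}_0$, respectively. Likewise, the commutative semigroups $(\mathcal{A}_0,+)$, $(\mathcal{M}_1,\cdot)$ and $(\mathcal{I}_{01},\cdot)$ are pairwise isomorphic in the same sense.
   Context: $\mathbb{N}$ is the set of positive integers. Arithmetic functions are functions $\mathbb{N}\to\mathbb{R}$; $+$ and $\cdot$ denote pointwise sum and product. $f$ is additive if $f(xy)=f(x)+f(y)$ for all coprime $x,y\in\mathbb{N}$; $g$ is multiplicative if $g$ is not identically zero and $g(xy)=g(x)g(y)$ for all coprime $x,y\in\mathbb{N}$. In the following sets, the inequalities are required for all $x\in\mathbb{N}$ with $x>1$: $\mathcal{A}=\{f\text{ additive}: f(x)\ge0\}$, $\mathcal{A}_0=\{f\in\mathcal{A}: f(x)>0\}$; $\mathcal{M}=\{g\text{ multiplicative}: g(x)\ge1\}$, $\mathcal{M}_1=\{g\in\mathcal{M}: g(x)>1\}$; $\mathcal{I}_0=\{h\text{ multiplicative}: 0<h(x)\le1\}$, $\mathcal{I}_{01}=\{h\text{ multiplicative}: 0<h(x)<1\}$. -}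

module Defs where

open import Level using (Level; suc)
open import Algebra.Core using (Op₁; Op₂)
open import Algebra.Definitions using (Identity)
open import Algebra.Structures
  using (IsCommutativeRing; IsCommutativeSemigroup; IsCommutativeMonoid)
open import Algebra.Bundles
  using (CommutativeRing; CommutativeSemigroup; CommutativeMonoid)
open import Algebra.Morphism.Structures
  using (module MagmaMorphisms; module MonoidMorphisms)
import Algebra.Construct.Pointwise as Pointwise
import Algebra.Properties.CommutativeSemigroup as CommutativeSemigroupProperties
import Algebra.Properties.Ring as RingProperties
open import Data.Irrelevant using ([_])
open import Data.Nat using (ℕ; NonZero; z≤n; s≤s) renaming (_*_ to _*ᴺ_; _<_ to _<ᴺ_)
open import Data.Nat.Coprimality using (Coprime)
open import Data.Nat.Properties using (m*n≢0)
open import Data.Product using (Σ; ∃; _×_; _,_; proj₁; proj₂)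
open import Data.Refinement using (Refinement-syntax; value; proof; _,_)
open import Data.Sum using (inj₁; inj₂)
open import Function.Bundles using (_⇔_)
open import Relation.Binary.Core using (Rel)
open import Relation.Binary.Structures using (IsStrictTotalOrder)
import Relation.Binary.Construct.StrictToNonStrict as NonStrict
open import Relation.Binary.Definitions using (tri<; tri≈; tri>)
open import Relation.Nullary using (¬_; contradiction)
open import Relation.Unary using (Pred; _∈_)

-- The real numbers are axiomatised as a Dedekind complete ordered field, which
-- classically determines them up to a unique isomorphism.
record CompleteOrderedField (ℓ : Level) : Set (suc ℓ) where
  infix  8 -_
  infixl 7 _*_
  infixl 6 _+_
  infix  4 _≈_ _<_
  field
    Carrier            : Set ℓ
    _≈_ _<_            : Rel Carrier ℓ
    _+_ _*_            : Op₂ Carrier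
    -_                 : Op₁ Carrier
    0# 1#              : Carrier
    isCommutativeRing  : IsCommutativeRing _≈_ _+_ _*_ -_ 0# 1#
    1≉0                : ¬ (1# ≈ 0#)
    inverse            : ∀ x → ¬ (x ≈ 0#) → ∃ λ y → x * y ≈ 1#
    isStrictTotalOrder : IsStrictTotalOrder _≈_ _<_
    +-monoʳ-<          : ∀ x {y z} → y < z → x + y < x + z
    *-positive         : ∀ {x y} → 0# < x → 0# < y → 0# < x * y

  open NonStrict _≈_ _<_ public using (_≤_)

  UpperBound : Pred Carrier ℓ → Pred Carrier ℓ
  UpperBound P b = ∀ x → x ∈ P → x ≤ b

  field
    supremum : (P : Pred Carrier ℓ) → ∃ P → ∃ (UpperBound P) →
               ∃ λ s → UpperBound P s × (∀ b → UpperBound P b → s ≤ b)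

ℕ⁺ : Set
ℕ⁺ = [ n ∈ ℕ ∣ NonZero n ]

infixl 7 _*⁺_
_*⁺_ : ℕ⁺ → ℕ⁺ → ℕ⁺
(m , [ p ]) *⁺ (n , [ q ]) = m *ᴺ n , [ m*n≢0 m n {{p}} {{q}} ]

2⁺ : ℕ⁺
2⁺ = 2 , [ _ ]

module ArithmeticFunctions {ℓ : Level} (R : CompleteOrderedField ℓ) where

  open CompleteOrderedField R renaming (Carrier to ℝ)
  open IsCommutativeRing isCommutativeRing
    using ( refl; sym; trans; +-cong; *-cong; +-comm; *-comm; +-identityˡ
          ; +-identityʳ; *-identityˡ; *-identityʳ; -‿inverseʳ; zeroˡ
          ; distribˡ; isEquivalence; +-isCommutativeMonoid
          ; *-isCommutativeMonoid )
  open IsStrictTotalOrder isStrictTotalOrder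
    using (compare; <-resp-≈; <-respˡ-≈; <-respʳ-≈)
    renaming (trans to <-trans; irrefl to <-irrefl)

  private
    ring : CommutativeRing ℓ ℓ
    ring = record { isCommutativeRing = isCommutativeRing }

    module RP = RingProperties (CommutativeRing.ring ring)
    module +M = CommutativeSemigroupProperties
                  (CommutativeRing.+-commutativeSemigroup ring)
    module *M = CommutativeSemigroupProperties
                  (CommutativeRing.*-commutativeSemigroup ring)
    module ≤M = NonStrict _≈_ _<_

  ArithmeticFunction : Set ℓ
  ArithmeticFunction = ℕ⁺ → ℝ

  SplitsAt : Op₂ ℝ → ArithmeticFunction → ℕ⁺ → ℕ⁺ → Set ℓ
  SplitsAt _∙_ f x y = f (x *⁺ y) ≈ (f x ∙ f y)

  Additive : Pred ArithmeticFunction ℓ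
  Additive f = ∀ x y → Coprime (value x) (value y) → SplitsAt _+_ f x y

  Multiplicative : Pred ArithmeticFunction ℓ
  Multiplicative g = ¬ (∀ x → g x ≈ 0#) ×
    (∀ x y → Coprime (value x) (value y) → SplitsAt _*_ g x y)

  Above1 : Pred ℝ ℓ → Pred ArithmeticFunction ℓ
  Above1 P f = ∀ x → 1 <ᴺ value x → P (f x)

  𝒜 𝒜₀ ℳ ℳ₁ ℐ₀ ℐ₀₁ : Pred ArithmeticFunction ℓ
  𝒜   f = Additive f       × Above1 (λ r → 0# ≤ r) f
  𝒜₀  f = f ∈ 𝒜            × Above1 (λ r → 0# < r) f
  ℳ   g = Multiplicative g × Above1 (λ r → 1# ≤ r) g
  ℳ₁  g = g ∈ ℳ            × Above1 (λ r → 1# < r) g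
  ℐ₀  h = Multiplicative h × Above1 (λ r → 0# < r × r ≤ 1#) h
  ℐ₀₁ h = Multiplicative h × Above1 (λ r → 0# < r × r < 1#) h

  pointwise : Op₂ ℝ → Op₂ ArithmeticFunction
  pointwise _∙_ f g x = f x ∙ g x

  record FunctionSemigroup : Set (suc ℓ) where
    field
      _∙_                    : Op₂ ℝ
      isCommutativeSemigroup : IsCommutativeSemigroup _≈_ _∙_
      Member                 : Pred ArithmeticFunction ℓ
      closed                 : ∀ {f g} → f ∈ Member → g ∈ Member →
                               pointwise _∙_ f g ∈ Member

    commutativeSemigroup : CommutativeSemigroup ℓ ℓ
    commutativeSemigroup = record
      { Carrier = Σ ArithmeticFunction Member
      ; _≈_     = λ f g → ∀ x → proj₁ f x ≈ proj₁ g x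
      ; _∙_     = λ f g → pointwise _∙_ (proj₁ f) (proj₁ g)
                        , closed (proj₂ f) (proj₂ g)
      ; isCommutativeSemigroup = record
        { isSemigroup = record
          { isMagma = record
            { isEquivalence = record
              { refl  = λ {f} → P.refl {proj₁ f}
              ; sym   = λ {f} {g} → P.sym {proj₁ f} {proj₁ g}
              ; trans = λ {f} {g} {h} → P.trans {proj₁ f} {proj₁ g} {proj₁ h}
              }
            ; ∙-cong = λ {f} {g} {h} {k} →
                P.∙-cong {proj₁ f} {proj₁ g} {proj₁ h} {proj₁ k}
            }
          ; assoc = λ f g h → P.assoc (proj₁ f) (proj₁ g) (proj₁ h)
          }
        ; comm = λ f g → P.comm (proj₁ f) (proj₁ g)
        }
      }
      where
      module P = IsCommutativeSemigroup
        (Pointwise.isCommutativeSemigroup ℕ⁺ isCommutativeSemigroup)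

  record FunctionMonoid : Set (suc ℓ) where
    field
      functionSemigroup : FunctionSemigroup

    open FunctionSemigroup functionSemigroup public

    field
      ε        : ℝ
      identity : Identity _≈_ ε _∙_
      ε-member : (λ _ → ε) ∈ Member

    commutativeMonoid : CommutativeMonoid ℓ ℓ
    commutativeMonoid = record
      { ε = (λ _ → ε) , ε-member
      ; isCommutativeMonoid = record
        { isMonoid = record
          { isSemigroup = S.isSemigroup
          ; identity    = (λ f x → proj₁ identity (proj₁ f x))
                        , (λ f x → proj₂ identity (proj₁ f x))
          }
        ; comm = S.comm
        }
      }
      where module S = CommutativeSemigroup commutativeSemigroup

  -- On members of S and T both functional equations hold by definition, so that
  -- carrying one to the other says something only about the map Φ on arbitrary
  -- arithmetic functions that the isomorphism is a restriction of.
  record EquationTransfer (S T : FunctionSemigroup) : Set ℓ where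
    private
      module S = FunctionSemigroup S
      module T = FunctionSemigroup T
    field
      Φ       : ArithmeticFunction → ArithmeticFunction
      mapsTo  : ∀ {f} → f ∈ S.Member → Φ f ∈ T.Member
      carries : ∀ f x y → Coprime (value x) (value y) →
                SplitsAt S._∙_ f x y ⇔ SplitsAt T._∙_ (Φ f) x y

    restriction : Σ ArithmeticFunction S.Member → Σ ArithmeticFunction T.Member
    restriction (f , f∈S) = Φ f , mapsTo f∈S

  infix 4 _≅ˢ_ _≅ᵐ_

  _≅ˢ_ : FunctionSemigroup → FunctionSemigroup → Set ℓ
  S ≅ˢ T = Σ (EquationTransfer S T) λ τ →
    IsMagmaIsomorphism (EquationTransfer.restriction τ)
    where
    open FunctionSemigroup
    open MagmaMorphisms
      (CommutativeSemigroup.rawMagma (commutativeSemigroup S))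
      (CommutativeSemigroup.rawMagma (commutativeSemigroup T))

  _≅ᵐ_ : FunctionMonoid → FunctionMonoid → Set ℓ
  S ≅ᵐ T = Σ (EquationTransfer (functionSemigroup S) (functionSemigroup T)) λ τ →
    IsMonoidIsomorphism (EquationTransfer.restriction τ)
    where
    open FunctionMonoid
    open MonoidMorphisms
      (CommutativeMonoid.rawMonoid (commutativeMonoid S))
      (CommutativeMonoid.rawMonoid (commutativeMonoid T))

  private
    ≤-trans : ∀ {x y z} → x ≤ y → y ≤ z → x ≤ z
    ≤-trans = ≤M.trans isEquivalence <-resp-≈ <-trans

    <-≤-trans : ∀ {x y z} → x < y → y ≤ z → x < z
    <-≤-trans = ≤M.<-≤-trans <-trans <-respʳ-≈

    +-monoʳ-≤ : ∀ x {y z} → y ≤ z → x + y ≤ x + z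
    +-monoʳ-≤ x (inj₁ y<z) = inj₁ (+-monoʳ-< x y<z)
    +-monoʳ-≤ x (inj₂ y≈z) = inj₂ (+-cong refl y≈z)

    *-monoʳ-< : ∀ {x y z} → 0# < x → y < z → x * y < x * z
    *-monoʳ-< {x} {y} {z} 0<x y<z =
      <-respʳ-≈ xy+x[z-y]≈xz
        (<-respˡ-≈ (+-identityʳ (x * y))
          (+-monoʳ-< (x * y) (*-positive 0<x 0<z-y)))
      where
      0<z-y : 0# < - y + z
      0<z-y = <-respˡ-≈ (trans (+-comm (- y) y) (-‿inverseʳ y))
                (+-monoʳ-< (- y) y<z)

      y+[z-y]≈z : y + (- y + z) ≈ z
      y+[z-y]≈z = trans (sym (CommutativeRing.+-assoc ring y (- y) z))
                    (trans (+-cong (-‿inverseʳ y) refl) (+-identityˡ z))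

      xy+x[z-y]≈xz : x * y + x * (- y + z) ≈ x * z
      xy+x[z-y]≈xz = trans (sym (distribˡ x y (- y + z)))
                       (*-cong refl y+[z-y]≈z)

    *-monoʳ-≤ : ∀ {x y z} → 0# < x → y ≤ z → x * y ≤ x * z
    *-monoʳ-≤ 0<x (inj₁ y<z) = inj₁ (*-monoʳ-< 0<x y<z)
    *-monoʳ-≤ 0<x (inj₂ y≈z) = inj₂ (*-cong refl y≈z)

    0<1 : 0# < 1#
    0<1 with compare 0# 1#
    ... | tri< p _ _ = p
    ... | tri≈ _ p _ = contradiction (sym p) 1≉0
    ... | tri> _ _ 1<0 = <-respʳ-≈ [-1][-1]≈1 (*-positive 0<-1 0<-1)
      where
      0<-1 : 0# < - 1#
      0<-1 = <-respˡ-≈ (trans (+-comm (- 1#) 1#) (-‿inverseʳ 1#))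
               (<-respʳ-≈ (+-identityʳ (- 1#)) (+-monoʳ-< (- 1#) 1<0))

      [-1][-1]≈1 : - 1# * - 1# ≈ 1#
      [-1][-1]≈1 = trans (RP.-1*x≈-x (- 1#)) (RP.-‿involutive 1#)

    +-nonneg : ∀ {x y} → 0# ≤ x → 0# ≤ y → 0# ≤ x + y
    +-nonneg {x} 0≤x 0≤y =
      ≤-trans 0≤x (≤-trans (inj₂ (sym (+-identityʳ x))) (+-monoʳ-≤ x 0≤y))

    +-positive : ∀ {x y} → 0# < x → 0# < y → 0# < x + y
    +-positive {x} 0<x 0<y =
      <-trans 0<x (<-respˡ-≈ (+-identityʳ x) (+-monoʳ-< x 0<y))

    *-≥1 : ∀ {x y} → 1# ≤ x → 1# ≤ y → 1# ≤ x * y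
    *-≥1 {x} 1≤x 1≤y = ≤-trans 1≤x
      (≤-trans (inj₂ (sym (*-identityʳ x))) (*-monoʳ-≤ (<-≤-trans 0<1 1≤x) 1≤y))

    *->1 : ∀ {x y} → 1# < x → 1# < y → 1# < x * y
    *->1 {x} 1<x 1<y = <-trans 1<x
      (<-respˡ-≈ (*-identityʳ x) (*-monoʳ-< (<-trans 0<1 1<x) 1<y))

    *-≤1 : ∀ {x y} → 0# < x × x ≤ 1# → 0# < y × y ≤ 1# →
           0# < x * y × x * y ≤ 1#
    *-≤1 {x} (0<x , x≤1) (0<y , y≤1) = *-positive 0<x 0<y
      , ≤-trans (*-monoʳ-≤ 0<x y≤1) (≤-trans (inj₂ (*-identityʳ x)) x≤1)

    *-<1 : ∀ {x y} → 0# < x × x < 1# → 0# < y × y < 1# →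
           0# < x * y × x * y < 1#
    *-<1 {x} (0<x , x<1) (0<y , y<1) = *-positive 0<x 0<y
      , <-trans (<-respʳ-≈ (*-identityʳ x) (*-monoʳ-< 0<x y<1)) x<1

    +-additive : ∀ {f g} → f ∈ Additive → g ∈ Additive →
                 pointwise _+_ f g ∈ Additive
    +-additive {f} {g} f-add g-add x y x⊥y =
      trans (+-cong (f-add x y x⊥y) (g-add x y x⊥y))
        (+M.interchange (f x) (f y) (g x) (g y))

    nonzero : ∀ {f} → Above1 (λ r → 0# < r) f → ¬ (∀ x → f x ≈ 0#)
    nonzero f>0 f≈0 = <-irrefl (sym (f≈0 2⁺)) (f>0 2⁺ (s≤s (s≤s z≤n)))

    *-multiplicative : ∀ {f g} → f ∈ Multiplicative → g ∈ Multiplicative →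
                       Above1 (λ r → 0# < r) f → Above1 (λ r → 0# < r) g →
                       pointwise _*_ f g ∈ Multiplicative
    *-multiplicative {f} {g} (_ , f-mul) (_ , g-mul) f>0 g>0 =
      nonzero (λ x 1<x → *-positive (f>0 x 1<x) (g>0 x 1<x)) , λ x y x⊥y →
        trans (*-cong (f-mul x y x⊥y) (g-mul x y x⊥y))
          (*M.interchange (f x) (f y) (g x) (g y))

    𝒜-closed : ∀ {f g} → f ∈ 𝒜 → g ∈ 𝒜 → pointwise _+_ f g ∈ 𝒜
    𝒜-closed (f-add , f≥0) (g-add , g≥0) = +-additive f-add g-add
      , λ x 1<x → +-nonneg (f≥0 x 1<x) (g≥0 x 1<x)

    ℳ-closed : ∀ {f g} → f ∈ ℳ → g ∈ ℳ → pointwise _*_ f g ∈ ℳ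
    ℳ-closed (f-mul , f≥1) (g-mul , g≥1) =
      *-multiplicative f-mul g-mul
        (λ x 1<x → <-≤-trans 0<1 (f≥1 x 1<x)) (λ x 1<x → <-≤-trans 0<1 (g≥1 x 1<x))
      , λ x 1<x → *-≥1 (f≥1 x 1<x) (g≥1 x 1<x)

    1-multiplicative : (λ _ → 1#) ∈ Multiplicative
    1-multiplicative = (λ 1≈0 → 1≉0 (1≈0 2⁺))
      , λ _ _ _ → sym (*-identityˡ 1#)

  𝒜₀-+ ℳ₁-* ℐ₀₁-* : FunctionSemigroup

  𝒜₀-+ = record
    { _∙_    = _+_
    ; isCommutativeSemigroup =
        IsCommutativeMonoid.isCommutativeSemigroup +-isCommutativeMonoid
    ; Member = 𝒜₀
    ; closed = λ (f∈𝒜 , f>0) (g∈𝒜 , g>0) → 𝒜-closed f∈𝒜 g∈𝒜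
                 , λ x 1<x → +-positive (f>0 x 1<x) (g>0 x 1<x)
    }

  ℳ₁-* = record
    { _∙_    = _*_
    ; isCommutativeSemigroup =
        IsCommutativeMonoid.isCommutativeSemigroup *-isCommutativeMonoid
    ; Member = ℳ₁
    ; closed = λ (f∈ℳ , f>1) (g∈ℳ , g>1) → ℳ-closed f∈ℳ g∈ℳ
                 , λ x 1<x → *->1 (f>1 x 1<x) (g>1 x 1<x)
    }

  ℐ₀₁-* = record
    { _∙_    = _*_
    ; isCommutativeSemigroup =
        IsCommutativeMonoid.isCommutativeSemigroup *-isCommutativeMonoid
    ; Member = ℐ₀₁
    ; closed = λ (f-mul , f-bd) (g-mul , g-bd) →
        *-multiplicative f-mul g-mul
          (λ x 1<x → proj₁ (f-bd x 1<x)) (λ x 1<x → proj₁ (g-bd x 1<x))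
        , λ x 1<x → *-<1 (f-bd x 1<x) (g-bd x 1<x)
    }

  𝒜-+ ℳ-* ℐ₀-* : FunctionMonoid

  𝒜-+ = record
    { functionSemigroup = record
      { _∙_    = _+_
      ; isCommutativeSemigroup =
          IsCommutativeMonoid.isCommutativeSemigroup +-isCommutativeMonoid
      ; Member = 𝒜
      ; closed = 𝒜-closed
      }
    ; ε        = 0#
    ; identity = +-identityˡ , +-identityʳ
    ; ε-member = (λ _ _ _ → sym (+-identityˡ 0#)) , λ _ _ → inj₂ refl
    }

  ℳ-* = record
    { functionSemigroup = record
      { _∙_    = _*_
      ; isCommutativeSemigroup =
          IsCommutativeMonoid.isCommutativeSemigroup *-isCommutativeMonoid
      ; Member = ℳ
      ; closed = ℳ-closed
      }
    ; ε        = 1#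
    ; identity = *-identityˡ , *-identityʳ
    ; ε-member = 1-multiplicative , λ _ _ → inj₂ refl
    }

  ℐ₀-* = record
    { functionSemigroup = record
      { _∙_    = _*_
      ; isCommutativeSemigroup =
          IsCommutativeMonoid.isCommutativeSemigroup *-isCommutativeMonoid
      ; Member = ℐ₀
      ; closed = λ (f-mul , f-bd) (g-mul , g-bd) →
          *-multiplicative f-mul g-mul
            (λ x 1<x → proj₁ (f-bd x 1<x)) (λ x 1<x → proj₁ (g-bd x 1<x))
          , λ x 1<x → *-≤1 (f-bd x 1<x) (g-bd x 1<x)
      }
    ; ε        = 1#
    ; identity = *-identityˡ , *-identityʳ
    ; ε-member = 1-multiplicative , λ _ _ → 0<1 , inj₂ refl
    }

{-# OPTIONS --safe #-}

-- Everything reduces to an isomorphism exp from (ℝ, +, <) to (ℝ₊, ·, <), composed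
-- with functions pointwise, and to the involution r ↦ 1/r.  The exponential comes
-- from Hölder's argument: log y is the supremum of the fractions (p − r)/q with
-- 2^(p − r) ≤ y^q.  Comparing the integer parts of q·log x, q·log y and q·log(xy)
-- for all q shows that log is a homomorphism, and completeness with density of
-- ℝ₊ makes it surjective.
module Submission where

open import Level using (Level) renaming (suc to lsuc)
open import Algebra.Bundles using (AbelianGroup; CommutativeRing)
open import Algebra.Core using (Op₁; Op₂)
open import Algebra.Morphism.Structures using (module MagmaMorphisms)
import Algebra.Properties.AbelianGroup as AbelianGroupProperties
import Algebra.Properties.CommutativeMonoid.Mult as Mult
import Algebra.Properties.CommutativeSemigroup as CommutativeSemigroupProperties
import Algebra.Properties.Ring as RingProperties
import Algebra.Properties.Semiring.Mult as SemiringMult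
open import Algebra.Structures
  using (IsAbelianGroup; IsCommutativeRing; IsCommutativeSemigroup)
open import Data.Empty using (⊥-elim)
open import Data.Nat as ℕ using (ℕ; zero; suc; z≤n; s≤s)
open import Data.Nat.Coprimality using (1-coprimeTo)
import Data.Nat.Properties as ℕ
open import Data.Product using (Σ; ∃; _×_; _,_; proj₁; proj₂)
open import Data.Refinement using (value; _,_)
open import Data.Sum using (_⊎_; inj₁; inj₂)
open import Function using (_∘_)
open import Function.Bundles using (mk⇔)
open import Relation.Binary.Bundles using (StrictTotalOrder)
import Relation.Binary.Construct.On as On
import Relation.Binary.Construct.StrictToNonStrict as NonStrict
open import Relation.Binary.Core using (Rel)
open import Relation.Binary.Definitions using (tri<; tri≈; tri>)
import Relation.Binary.Properties.StrictTotalOrder as StrictTotalOrderProperties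
open import Relation.Binary.PropositionalEquality as ≡ using ()
import Relation.Binary.Reasoning.StrictPartialOrder as StrictReasoning
open import Relation.Binary.Structures using (IsStrictTotalOrder)
open import Relation.Nullary using (¬_; contradiction; yes; no)
open import Relation.Unary using (Pred; _∈_)
open import Defs

-- Ordered abelian groups

-- Excluded middle is not assumed for arbitrary propositions; what is decidable is the order. The
-- existence of large multiples and of integer parts is proved by contradiction, hence only under a
-- double negation. That suffices wherever the goal is an inequality, because `≤` is stable. A
-- supremum is data and cannot be extracted in this way, which is why completeness is strengthened
-- to `Complete`.
--
-- ℝ under addition and the positive reals under multiplication are two instances of one structure;
-- in the second, `n · x` is the power x^n and `0#` is 1. Besides completeness, Hölder's argument
-- asks for a dense source and a divisible target. Midpoints make the positive reals dense and
-- division by n + 1 makes ℝ divisible, whereas the opposite direction would require roots of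
-- positive reals. Hence the logarithm is built first and the exponential is its inverse.

record OrderedAbelianGroup (ℓ : Level) : Set (lsuc ℓ) where
  infix  8 -_
  infixl 6 _+_
  infix  4 _≈_ _<_
  field
    Carrier            : Set ℓ
    _≈_ _<_            : Rel Carrier ℓ
    _+_                : Op₂ Carrier
    0#                 : Carrier
    -_                 : Op₁ Carrier
    isAbelianGroup     : IsAbelianGroup _≈_ _+_ 0# -_
    isStrictTotalOrder : IsStrictTotalOrder _≈_ _<_
    +-monoʳ-<          : ∀ x {y z} → y < z → x + y < x + z

  abelianGroup : AbelianGroup ℓ ℓ
  abelianGroup = record { isAbelianGroup = isAbelianGroup }

  strictTotalOrder : StrictTotalOrder ℓ ℓ ℓ
  strictTotalOrder = record { isStrictTotalOrder = isStrictTotalOrder }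

  open NonStrict _≈_ _<_ public using (_≤_)
  open AbelianGroup abelianGroup public
    using (refl; sym; trans)
    renaming ( ∙-cong to +-cong; ∙-congˡ to +-congˡ; ∙-congʳ to +-congʳ
             ; assoc to +-assoc; comm to +-comm
             ; identityˡ to +-identityˡ; identityʳ to +-identityʳ
             ; inverseˡ to -‿inverseˡ; inverseʳ to -‿inverseʳ; ⁻¹-cong to -‿cong)
  open Mult (AbelianGroup.commutativeMonoid abelianGroup) public renaming (_×_ to _·_)

  UpperBound : Pred Carrier ℓ → Pred Carrier ℓ
  UpperBound P b = ∀ x → x ∈ P → x ≤ b

  Supremum : Pred Carrier ℓ → Pred Carrier ℓ
  Supremum P s = UpperBound P s × (∀ b → UpperBound P b → s ≤ b)

  -- Suprema exist even where inhabitants and bounds are only known not to be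
  -- absent: the order is decidable, but the Archimedean property holds only up
  -- to double negation.
  Complete : Set (lsuc ℓ)
  Complete = ∀ P → ¬ ¬ ∃ P → ¬ ¬ ∃ (UpperBound P) → ∃ (Supremum P)

  Dense : Set ℓ
  Dense = ∀ x → 0# < x → ∃ λ y → 0# < y × y < x

  Divisible : Set ℓ
  Divisible = ∀ n x → ∃ λ y → suc n · y ≈ x

module OrderedAbelianGroupProperties {ℓ : Level} (G : OrderedAbelianGroup ℓ) where

  open OrderedAbelianGroup G
  open AbelianGroupProperties abelianGroup
  open AbelianGroupProperties abelianGroup public using (identityˡ-unique)
  open CommutativeSemigroupProperties
    (AbelianGroup.commutativeSemigroup abelianGroup) public using (interchange)
  open IsStrictTotalOrder isStrictTotalOrder public
    using (compare; irrefl; _<?_; <-respˡ-≈; <-respʳ-≈) renaming (trans to <-trans)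
  open StrictTotalOrderProperties strictTotalOrder public
    using (≤-respˡ-≈; ≤-respʳ-≈)
    renaming (trans to ≤-trans; antisym to ≤-antisym)
  open StrictReasoning (StrictTotalOrder.strictPartialOrder strictTotalOrder)

  -- The gateway from refutations to inequalities: through it, double negated existence statements
  -- can be used in proofs of `≤`.
  ≮⇒≥ : ∀ {x y} → ¬ (x < y) → y ≤ x
  ≮⇒≥ {x} {y} x≮y with compare x y
  ... | tri< x<y _ _ = contradiction x<y x≮y
  ... | tri≈ _ x≈y _ = inj₂ (sym x≈y)
  ... | tri> _ _ y<x = inj₁ y<x

  ≤⇒≯ : ∀ {x y} → x ≤ y → ¬ (y < x)
  ≤⇒≯ {x} {y} x≤y y<x = irrefl refl (begin-strict x ≤⟨ x≤y ⟩ y <⟨ y<x ⟩ x ∎)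

  ≤-<-connex : ∀ x y → x ≤ y ⊎ y < x
  ≤-<-connex x y with y <? x
  ... | yes y<x = inj₂ y<x
  ... | no  y≮x = inj₁ (≮⇒≥ y≮x)

  +-monoʳ-≤ : ∀ x {y z} → y ≤ z → x + y ≤ x + z
  +-monoʳ-≤ x (inj₁ y<z) = inj₁ (+-monoʳ-< x y<z)
  +-monoʳ-≤ x (inj₂ y≈z) = inj₂ (+-congˡ y≈z)

  +-monoˡ-< : ∀ x {y z} → y < z → y + x < z + x
  +-monoˡ-< x {y} {z} y<z = begin-strict
    y + x  ≈⟨ +-comm y x ⟩
    x + y  <⟨ +-monoʳ-< x y<z ⟩
    x + z  ≈⟨ +-comm x z ⟩
    z + x  ∎

  +-monoˡ-≤ : ∀ x {y z} → y ≤ z → y + x ≤ z + x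
  +-monoˡ-≤ x (inj₁ y<z) = inj₁ (+-monoˡ-< x y<z)
  +-monoˡ-≤ x (inj₂ y≈z) = inj₂ (+-congʳ y≈z)

  +-mono-≤ : ∀ {w x y z} → w ≤ x → y ≤ z → w + y ≤ x + z
  +-mono-≤ {w} {x} {y} {z} w≤x y≤z = begin
    w + y  ≤⟨ +-monoʳ-≤ w y≤z ⟩
    w + z  ≤⟨ +-monoˡ-≤ z w≤x ⟩
    x + z  ∎

  +-mono-<-≤ : ∀ {w x y z} → w < x → y ≤ z → w + y < x + z
  +-mono-<-≤ {w} {x} {y} {z} w<x y≤z = begin-strict
    w + y  ≤⟨ +-monoʳ-≤ w y≤z ⟩
    w + z  <⟨ +-monoˡ-< z w<x ⟩
    x + z  ∎

  +-cancelˡ-< : ∀ x {y z} → x + y < x + z → y < z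
  +-cancelˡ-< x {y} {z} x+y<x+z with ≤-<-connex z y
  ... | inj₁ z≤y = contradiction x+y<x+z (≤⇒≯ (+-monoʳ-≤ x z≤y))
  ... | inj₂ y<z = y<z

  +-cancelʳ-≤ : ∀ x {y z} → y + x ≤ z + x → y ≤ z
  +-cancelʳ-≤ x y+x≤z+x = ≮⇒≥ λ z<y → ≤⇒≯ y+x≤z+x (+-monoˡ-< x z<y)

  x<x+y : ∀ x {y} → 0# < y → x < x + y
  x<x+y x {y} 0<y = begin-strict
    x       ≈⟨ +-identityʳ x ⟨
    x + 0#  <⟨ +-monoʳ-< x 0<y ⟩
    x + y   ∎

  x+[y-x]≈y : ∀ x y → x + (y + - x) ≈ y
  x+[y-x]≈y x y = trans (sym (+-assoc x y (- x))) (xyx⁻¹≈y x y)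

  x-y+y≈x : ∀ x y → x + - y + y ≈ x
  x-y+y≈x x y = trans (+-comm (x + - y) y) (x+[y-x]≈y y x)

  0<y-x : ∀ {x y} → x < y → 0# < y + - x
  0<y-x {x} {y} x<y = begin-strict
    0#       ≈⟨ -‿inverseʳ x ⟨
    x + - x  <⟨ +-monoˡ-< (- x) x<y ⟩
    y + - x  ∎

  x-y<x : ∀ x {y} → 0# < y → x + - y < x
  x-y<x x {y} 0<y = begin-strict
    x + - y      <⟨ x<x+y (x + - y) 0<y ⟩
    x + - y + y  ≈⟨ x-y+y≈x x y ⟩
    x            ∎

  -‿anti-< : ∀ {x y} → x < y → - y < - x
  -‿anti-< {x} {y} x<y = +-cancelˡ-< x (begin-strict
    x + - y  <⟨ +-monoˡ-< (- y) x<y ⟩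
    y + - y  ≈⟨ -‿inverseʳ y ⟩
    0#       ≈⟨ -‿inverseʳ x ⟨
    x + - x  ∎)

  -‿anti-≤ : ∀ {x y} → x ≤ y → - y ≤ - x
  -‿anti-≤ (inj₁ x<y) = inj₁ (-‿anti-< x<y)
  -‿anti-≤ (inj₂ x≈y) = inj₂ (-‿cong (sym x≈y))

  x≤-y⇒y≤-x : ∀ {x y} → x ≤ - y → y ≤ - x
  x≤-y⇒y≤-x {x} {y} x≤-y = begin
    y      ≈⟨ ⁻¹-involutive y ⟨
    - - y  ≤⟨ -‿anti-≤ x≤-y ⟩
    - x    ∎

  ·-monoʳ-≤ : ∀ n {x y} → x ≤ y → n · x ≤ n · y
  ·-monoʳ-≤ zero        _   = inj₂ refl
  ·-monoʳ-≤ (suc n) x≤y = +-mono-≤ x≤y (·-monoʳ-≤ n x≤y)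

  ·-monoʳ-< : ∀ n {x y} → x < y → suc n · x < suc n · y
  ·-monoʳ-< n x<y = +-mono-<-≤ x<y (·-monoʳ-≤ n (inj₁ x<y))

  ·-cancelˡ-< : ∀ n {x y} → n · x < n · y → x < y
  ·-cancelˡ-< n {x} {y} nx<ny with ≤-<-connex y x
  ... | inj₁ y≤x = contradiction nx<ny (≤⇒≯ (·-monoʳ-≤ n y≤x))
  ... | inj₂ x<y = x<y

  ·-cancelˡ-≤ : ∀ n {x y} → suc n · x ≤ suc n · y → x ≤ y
  ·-cancelˡ-≤ n nx≤ny = ≮⇒≥ λ y<x → ≤⇒≯ nx≤ny (·-monoʳ-< n y<x)

  0≤n·x : ∀ n {x} → 0# < x → 0# ≤ n · x
  0≤n·x zero        _   = inj₂ refl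
  0≤n·x (suc n) {x} 0<x = begin
    0#         ≈⟨ +-identityˡ 0# ⟨
    0# + 0#    ≤⟨ +-mono-≤ (inj₁ 0<x) (0≤n·x n 0<x) ⟩
    x + n · x  ∎

  0<sn·x : ∀ n {x} → 0# < x → 0# < suc n · x
  0<sn·x n {x} 0<x = begin-strict
    0#         ≈⟨ +-identityˡ 0# ⟨
    0# + 0#    <⟨ +-mono-<-≤ 0<x (0≤n·x n 0<x) ⟩
    x + n · x  ∎

  ·-monoˡ-≤ : ∀ {m n x} → 0# < x → m ℕ.≤ n → m · x ≤ n · x
  ·-monoˡ-≤ 0<x (z≤n {n})         = 0≤n·x n 0<x
  ·-monoˡ-≤ {x = x} 0<x (s≤s m≤n) = +-monoʳ-≤ x (·-monoˡ-≤ 0<x m≤n)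

  ·-cancelʳ-≤ : ∀ {m n x} → 0# < x → m · x ≤ n · x → m ℕ.≤ n
  ·-cancelʳ-≤ {zero}              _   _     = z≤n
  ·-cancelʳ-≤ {suc m} {zero}    0<x mx≤nx =
    contradiction (0<sn·x m 0<x) (≤⇒≯ mx≤nx)
  ·-cancelʳ-≤ {suc m} {suc n} {x} 0<x mx≤nx =
    s≤s (·-cancelʳ-≤ 0<x (≮⇒≥ λ nx<mx → ≤⇒≯ mx≤nx (+-monoʳ-< x nx<mx)))

  ·-comm : ∀ m n x → m · (n · x) ≈ n · (m · x)
  ·-comm m n x = begin-equality
    m · (n · x)    ≈⟨ ×-assocˡ x m n ⟩
    (m ℕ.* n) · x  ≡⟨ ≡.cong (_· x) (ℕ.*-comm m n) ⟩
    (n ℕ.* m) · x  ≈⟨ ×-assocˡ x n m ⟨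
    n · (m · x)    ∎

  -- The pair (p , r) stands for the integer p − r.
  infixl 7 _⊙_
  _⊙_ : ℕ × ℕ → Carrier → Carrier
  (p , r) ⊙ x = p · x + - (r · x)

  private
    rearrange : ∀ w x y z → (w + x) + - (y + z) ≈ (w + - y) + (x + - z)
    rearrange w x y z = trans (+-congˡ (sym (⁻¹-∙-comm y z))) (interchange w x (- y) (- z))

  infixl 6 _⊕_
  _⊕_ : ℕ × ℕ → ℕ × ℕ → ℕ × ℕ
  (p , r) ⊕ (p′ , r′) = p ℕ.+ p′ , r ℕ.+ r′

  ⊙-homo-⊕ : ∀ k l x → (k ⊕ l) ⊙ x ≈ k ⊙ x + l ⊙ x
  ⊙-homo-⊕ (p , r) (p′ , r′) x = trans
    (+-cong (×-homo-+ x p p′) (-‿cong (×-homo-+ x r r′)))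
    (rearrange (p · x) (p′ · x) (r · x) (r′ · x))

  infixr 7 _⊛_
  _⊛_ : ℕ → ℕ × ℕ → ℕ × ℕ
  n ⊛ (p , r) = n ℕ.* p , n ℕ.* r

  ⊙-·-comm : ∀ n k x → n · (k ⊙ x) ≈ (n ⊛ k) ⊙ x
  ⊙-·-comm n (p , r) x = begin-equality
    n · (p · x + - (r · x))          ≈⟨ ×-distrib-+ (p · x) (- (r · x)) n ⟩
    n · (p · x) + n · - (r · x)      ≈⟨ +-cong (×-assocˡ x n p) (·-neg n (r · x)) ⟩
    (n ℕ.* p) · x + - (n · (r · x))    ≈⟨ +-congˡ (-‿cong (×-assocˡ x n r)) ⟩
    (n ℕ.* p) · x + - ((n ℕ.* r) · x)    ∎
    where
    ·-neg : ∀ n x → n · - x ≈ - (n · x)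
    ·-neg zero      x = sym ε⁻¹≈ε
    ·-neg (suc n) x = trans (+-congˡ (·-neg n x)) (⁻¹-∙-comm x (n · x))

  ⊙-one : ∀ x → (1 , 0) ⊙ x ≈ x
  ⊙-one x = begin-equality
    x + 0# + - 0#  ≈⟨ +-cong (+-identityʳ x) ε⁻¹≈ε ⟩
    x + 0#         ≈⟨ +-identityʳ x ⟩
    x              ∎

  ⊙-next : ∀ k x → (k ⊕ (1 , 0)) ⊙ x ≈ k ⊙ x + x
  ⊙-next k x = trans (⊙-homo-⊕ k (1 , 0) x) (+-congˡ (⊙-one x))

  infix 4 _≼_
  -- The order of the integers p - r and p′ - r′, with both subtractions moved across.
  _≼_ : Rel (ℕ × ℕ) _
  (p , r) ≼ (p′ , r′) = p ℕ.+ r′ ℕ.≤ p′ ℕ.+ r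

  private
    x-y+[y+w]≈x+w : ∀ x y w → x + - y + (y + w) ≈ x + w
    x-y+[y+w]≈x+w x y w = trans (sym (+-assoc (x + - y) y w)) (+-congʳ (x-y+y≈x x y))

    z-w+[y+w]≈z+y : ∀ z y w → z + - w + (y + w) ≈ z + y
    z-w+[y+w]≈z+y z y w = trans (+-congˡ (+-comm y w)) (x-y+[y+w]≈x+w z w y)

  ⊙-≼⇒≤ : ∀ {k l x} → 0# < x → k ≼ l → k ⊙ x ≤ l ⊙ x
  ⊙-≼⇒≤ {p , r} {p′ , r′} {x} 0<x k≼l = +-cancelʳ-≤ (r · x + r′ · x) (begin
    p · x + - (r · x) + (r · x + r′ · x)    ≈⟨ x-y+[y+w]≈x+w (p · x) (r · x) (r′ · x) ⟩
    p · x + r′ · x                          ≈⟨ ×-homo-+ x p r′ ⟨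
    (p ℕ.+ r′) · x                          ≤⟨ ·-monoˡ-≤ 0<x k≼l ⟩
    (p′ ℕ.+ r) · x                          ≈⟨ ×-homo-+ x p′ r ⟩
    p′ · x + r · x                          ≈⟨ z-w+[y+w]≈z+y (p′ · x) (r · x) (r′ · x) ⟨
    p′ · x + - (r′ · x) + (r · x + r′ · x)  ∎)

  ⊙-≤⇒≼ : ∀ {k l x} → 0# < x → k ⊙ x ≤ l ⊙ x → k ≼ l
  ⊙-≤⇒≼ {p , r} {p′ , r′} {x} 0<x kx≤lx = ·-cancelʳ-≤ 0<x (begin
    (p ℕ.+ r′) · x                          ≈⟨ ×-homo-+ x p r′ ⟩
    p · x + r′ · x                          ≈⟨ x-y+[y+w]≈x+w (p · x) (r · x) (r′ · x) ⟨
    p · x + - (r · x) + (r · x + r′ · x)    ≤⟨ +-monoˡ-≤ (r · x + r′ · x) kx≤lx ⟩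
    p′ · x + - (r′ · x) + (r · x + r′ · x)  ≈⟨ z-w+[y+w]≈z+y (p′ · x) (r · x) (r′ · x) ⟩
    p′ · x + r · x                          ≈⟨ ×-homo-+ x p′ r ⟨
    (p′ ℕ.+ r) · x                          ∎)

  -- Archimedean property and integer parts

  module _ (complete : Complete) where

    -- Otherwise the multiples of `a` have a supremum s. Adding `a` to a multiple gives a multiple,
    -- so s - a bounds them as well, against minimality.
    archimedean : ∀ {a} → 0# < a → ∀ x → ¬ ¬ ∃ λ n → x < n · a
    archimedean {a} 0<a x ∄n = ≤⇒≯ (least (s + - a) s-a-upper) (x-y<x s 0<a)
      where
      Multiple : Pred Carrier ℓ
      Multiple y = ∃ λ n → y ≈ n · a

      multiples-bounded : UpperBound Multiple x
      multiples-bounded y (n , y≈na) =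
        ≮⇒≥ λ x<y → ∄n (n , <-respʳ-≈ y≈na x<y)

      s-sup : ∃ (Supremum Multiple)
      s-sup = complete Multiple (λ ∄y → ∄y (0# , 0 , refl)) (λ ∄b → ∄b (x , multiples-bounded))

      s = proj₁ s-sup
      upper = proj₁ (proj₂ s-sup)
      least = proj₂ (proj₂ s-sup)

      s-a-upper : UpperBound Multiple (s + - a)
      s-a-upper y (n , y≈na) = +-cancelʳ-≤ a (begin
        y + a              ≈⟨ +-comm y a ⟩
        a + y              ≤⟨ upper (a + y) (suc n , +-congˡ y≈na) ⟩
        s                  ≈⟨ x-y+y≈x s a ⟨
        s + - a + a        ∎)

    floor : ∀ {a} → 0# < a → ∀ x →
            ¬ ¬ ∃ λ k → k ⊙ a ≤ x × x < (k ⊕ (1 , 0)) ⊙ a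
    floor {a} 0<a x ∄k =
      -- Adding r · a makes x nonnegative, so that a downward search through ℕ finds the integer
      -- part p; shifting back gives p - r.
      archimedean 0<a (- x) λ (r , -x<ra) →
      archimedean 0<a (x + r · a) λ (n , x+ra<na) →
      let p , pa≤x+ra , x+ra<pa+a = search n (0≤x+ra r -x<ra) x+ra<na
          k≤x = +-cancelʳ-≤ (r · a) (begin
            p · a + - (r · a) + r · a  ≈⟨ x-y+y≈x (p · a) (r · a) ⟩
            p · a                      ≤⟨ pa≤x+ra ⟩
            x + r · a                  ∎)
          x<k+1 = begin-strict
            x                         ≈⟨ +-identityʳ x ⟨
            x + 0#                    ≈⟨ +-congˡ (-‿inverseʳ (r · a)) ⟨
            x + (r · a + - (r · a))   ≈⟨ +-assoc x (r · a) (- (r · a)) ⟨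
            x + r · a + - (r · a)     <⟨ +-monoˡ-< (- (r · a)) x+ra<pa+a ⟩
            a + p · a + - (r · a)     ≈⟨ +-assoc a (p · a) (- (r · a)) ⟩
            a + (p , r) ⊙ a           ≈⟨ +-comm a ((p , r) ⊙ a) ⟩
            (p , r) ⊙ a + a           ≈⟨ ⊙-next (p , r) a ⟨
            ((p , r) ⊕ (1 , 0)) ⊙ a   ∎
      in ∄k ((p , r) , k≤x , x<k+1)
      where
      0≤x+ra : ∀ r → - x < r · a → 0# ≤ x + r · a
      0≤x+ra r -x<ra = begin
        0#         ≈⟨ -‿inverseʳ x ⟨
        x + - x    <⟨ +-monoʳ-< x -x<ra ⟩
        x + r · a  ∎

      search : ∀ n {z} → 0# ≤ z → z < n · a →
               ∃ λ p → p · a ≤ z × z < suc p · a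
      search zero      0≤z z<0 = contradiction z<0 (≤⇒≯ 0≤z)
      search (suc n) {z} 0≤z z<sna with ≤-<-connex (n · a) z
      ... | inj₁ na≤z = n , na≤z , z<sna
      ... | inj₂ z<na = search n 0≤z z<na

    -- An error that stays below one `c` for all multiples cannot hide a positive x - y, whose
    -- multiples exceed `c`.
    ·-bounded-gap : ∀ {x y c} → (∀ n → suc n · x ≤ suc n · y + c) → x ≤ y
    ·-bounded-gap {x} {y} {c} gap = ≮⇒≥ λ y<x →
      archimedean (0<y-x y<x) c λ (n , c<n[x-y]) →
      irrefl refl (begin-strict
        suc n · x                        ≤⟨ gap n ⟩
        suc n · y + c                    <⟨ +-monoʳ-< (suc n · y) c<n[x-y] ⟩
        suc n · y + n · (x + - y)        ≤⟨ +-monoʳ-≤ (suc n · y)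
          (·-monoˡ-≤ (0<y-x y<x) (ℕ.n≤1+n n)) ⟩
        suc n · y + suc n · (x + - y)  ≈⟨ ×-distrib-+ y (x + - y) (suc n) ⟨
        suc n · (y + (x + - y))          ≈⟨ ×-congʳ (suc n) (x+[y-x]≈y y x) ⟩
        suc n · x                        ∎)

  module _ (dense : Dense) where

    -- Replaces division by n in a group that is only known to be dense. Given n · e < a, pick d
    -- below the remaining gap; the smaller of d and e fits n + 1 times.
    small-multiple : ∀ n {a} → 0# < a → ∃ λ e → 0# < e × n · e < a
    small-multiple zero      {a} 0<a = a , 0<a , 0<a
    small-multiple (suc n) {a} 0<a
      with e , 0<e , ne<a ← small-multiple n 0<a
      with d , 0<d , d<a-ne ← dense (a + - (n · e)) (0<y-x ne<a)
      with ≤-<-connex e d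
    ... | inj₁ e≤d = e , 0<e , (begin-strict
      e + n · e                ≤⟨ +-monoˡ-≤ (n · e) e≤d ⟩
      d + n · e                <⟨ +-monoˡ-< (n · e) d<a-ne ⟩
      a + - (n · e) + n · e    ≈⟨ x-y+y≈x a (n · e) ⟩
      a                        ∎)
    ... | inj₂ d<e = d , 0<d , (begin-strict
      d + n · d                ≤⟨ +-monoʳ-≤ d (·-monoʳ-≤ n (inj₁ d<e)) ⟩
      d + n · e                <⟨ +-monoˡ-< (n · e) d<a-ne ⟩
      a + - (n · e) + n · e    ≈⟨ x-y+y≈x a (n · e) ⟩
      a                        ∎)

-- Isomorphisms of ordered abelian groups

record OrderedGroupIsomorphism {ℓ : Level} (G H : OrderedAbelianGroup ℓ) : Set ℓ where
  private
    module G = OrderedAbelianGroup G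
    module H = OrderedAbelianGroup H
    module GP = OrderedAbelianGroupProperties G
    module HP = OrderedAbelianGroupProperties H
  field
    ⟦_⟧         : G.Carrier → H.Carrier
    ⟦⟧-cong     : ∀ {x y} → x G.≈ y → ⟦ x ⟧ H.≈ ⟦ y ⟧
    +-homo      : ∀ x y → ⟦ x G.+ y ⟧ H.≈ ⟦ x ⟧ H.+ ⟦ y ⟧
    mono-<      : ∀ {x y} → x G.< y → ⟦ x ⟧ H.< ⟦ y ⟧
    surjective  : ∀ y → ∃ λ x → ⟦ x ⟧ H.≈ y

  mono-≤ : ∀ {x y} → x G.≤ y → ⟦ x ⟧ H.≤ ⟦ y ⟧
  mono-≤ (inj₁ x<y) = inj₁ (mono-< x<y)
  mono-≤ (inj₂ x≈y) = inj₂ (⟦⟧-cong x≈y)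

  -- Totality of the source order turns preservation of the order into reflection; antisymmetry then
  -- gives `injective`.
  cancel-< : ∀ {x y} → ⟦ x ⟧ H.< ⟦ y ⟧ → x G.< y
  cancel-< {x} {y} fx<fy with GP.≤-<-connex y x
  ... | inj₁ y≤x = contradiction fx<fy (HP.≤⇒≯ (mono-≤ y≤x))
  ... | inj₂ x<y = x<y

  cancel-≤ : ∀ {x y} → ⟦ x ⟧ H.≤ ⟦ y ⟧ → x G.≤ y
  cancel-≤ fx≤fy = GP.≮⇒≥ λ y<x → HP.≤⇒≯ fx≤fy (mono-< y<x)

  injective : ∀ {x y} → ⟦ x ⟧ H.≈ ⟦ y ⟧ → x G.≈ y
  injective fx≈fy = GP.≤-antisym (cancel-≤ (inj₂ fx≈fy)) (cancel-≤ (inj₂ (H.sym fx≈fy)))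

  0#-homo : ⟦ G.0# ⟧ H.≈ H.0#
  0#-homo = HP.identityˡ-unique ⟦ G.0# ⟧ ⟦ G.0# ⟧
    (H.trans (H.sym (+-homo G.0# G.0#)) (⟦⟧-cong (G.+-identityˡ G.0#)))

inverseIsomorphism : ∀ {ℓ} {G H : OrderedAbelianGroup ℓ} →
          OrderedGroupIsomorphism G H → OrderedGroupIsomorphism H G
inverseIsomorphism {G = G} {H} φ = record
  { ⟦_⟧        = λ y → proj₁ (surjective y)
  ; ⟦⟧-cong    = λ {x} {y} x≈y → injective
      (trans (section x) (trans x≈y (sym (section y))))
  ; +-homo     = λ x y → injective (trans (section (x + y)) (sym
      (trans (+-homo _ _) (+-cong (section x) (section y)))))
  ; mono-<     = λ {x} {y} x<y → cancel-<
      (<-respʳ-≈ (sym (section y)) (<-respˡ-≈ (sym (section x)) x<y))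
  ; surjective = λ x → ⟦ x ⟧ , injective (section ⟦ x ⟧)
  }
  where
  open OrderedGroupIsomorphism φ
  open OrderedAbelianGroup H
  open OrderedAbelianGroupProperties H
  section = λ y → proj₂ (surjective y)

-- Hölder's construction by cuts

module Hölder {ℓ : Level} (G H : OrderedAbelianGroup ℓ)
  (G-complete : OrderedAbelianGroup.Complete G)
  (G-dense : OrderedAbelianGroup.Dense G)
  (H-complete : OrderedAbelianGroup.Complete H)
  (H-divisible : OrderedAbelianGroup.Divisible H)
  where

  private
    module G where
      open OrderedAbelianGroup G public
      open OrderedAbelianGroupProperties G public
    module H where
      open OrderedAbelianGroup H public
      open OrderedAbelianGroupProperties H public
    module ≤G = StrictReasoning (StrictTotalOrder.strictPartialOrder G.strictTotalOrder)
  open G using (_⊕_; _⊛_)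
  open StrictReasoning (StrictTotalOrder.strictPartialOrder H.strictTotalOrder)

  module _ {a b} (0<a : G.0# G.< a) (0<b : H.0# H.< b) where

    private
      -- The comparison of two integer multiples of a positive element depends on the integers
      -- alone, so it passes through `≼` from one group to the other.
      transfer-≤ : ∀ {k l} → k G.⊙ a G.≤ l G.⊙ a → k H.⊙ b H.≤ l H.⊙ b
      transfer-≤ {k} {l} ka≤la = H.⊙-≼⇒≤ {k} {l} 0<b (G.⊙-≤⇒≼ {k} {l} 0<a ka≤la)

      -- y ≤ (k / (n + 1)) b for some fraction k / (n + 1) below x / a.
      Cut : G.Carrier → Pred H.Carrier ℓ
      Cut x y = ∃ λ n → ∃ λ k → k G.⊙ a G.≤ suc n G.· x × suc n H.· y H.≤ k H.⊙ b

      -- Cross-multiplication: from l / M ≤ x / a ≤ k / N follows N l ≤ M k, and this integer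
      -- inequality can be read in `H`.
      Cut-below : ∀ {x y} n k → y ∈ Cut x → suc n G.· x G.≤ k G.⊙ a →
                  suc n H.· y H.≤ k H.⊙ b
      Cut-below {x} {y} n k (m , l , la≤mx , my≤lb) nx≤ka = H.·-cancelˡ-≤ m (begin
        M H.· (N H.· y)  ≈⟨ H.·-comm M N y ⟩
        N H.· (M H.· y)  ≤⟨ H.·-monoʳ-≤ N my≤lb ⟩
        N H.· (l H.⊙ b)  ≈⟨ H.⊙-·-comm N l b ⟩
        (N ⊛ l) H.⊙ b    ≤⟨ transfer-≤ {N ⊛ l} {M ⊛ k} Nla≤Mka ⟩
        (M ⊛ k) H.⊙ b    ≈⟨ H.⊙-·-comm M k b ⟨
        M H.· (k H.⊙ b)  ∎)
        where
        M = suc m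
        N = suc n
        Nla≤Mka : (N ⊛ l) G.⊙ a G.≤ (M ⊛ k) G.⊙ a
        Nla≤Mka = ≤G.begin
          (N ⊛ l) G.⊙ a    ≤G.≈⟨ G.⊙-·-comm N l a ⟨
          N G.· (l G.⊙ a)  ≤G.≤⟨ G.·-monoʳ-≤ N la≤mx ⟩
          N G.· (M G.· x)  ≤G.≈⟨ G.·-comm N M x ⟩
          M G.· (N G.· x)  ≤G.≤⟨ G.·-monoʳ-≤ M nx≤ka ⟩
          M G.· (k G.⊙ a)  ≤G.≈⟨ G.⊙-·-comm M k a ⟩
          (M ⊛ k) G.⊙ a    ≤G.∎

      abstract
        -- Denominator 1 suffices: if k is the integer part of x / a, then k b lies in the cut and
        -- (k + 1) b bounds it.
        Cut-supremum : ∀ x → ∃ (H.Supremum (Cut x))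
        Cut-supremum x = H-complete (Cut x)
          (λ ∄y → G.floor G-complete 0<a x λ (k , ka≤x , _) →
            ∄y (k H.⊙ b , 0 , k , G.≤-respʳ-≈ (G.sym (G.+-identityʳ x)) ka≤x
                               , inj₂ (H.+-identityʳ (k H.⊙ b))))
          (λ ∄c → G.floor G-complete 0<a x λ (k , _ , x<ka+a) →
            ∄c ((k ⊕ (1 , 0)) H.⊙ b , λ y y∈Cut →
              H.≤-respˡ-≈ (H.+-identityʳ y) (Cut-below 0 (k ⊕ (1 , 0)) y∈Cut
                (inj₁ (G.<-respˡ-≈ (G.sym (G.+-identityʳ x)) x<ka+a)))))

      f : G.Carrier → H.Carrier
      f x = proj₁ (Cut-supremum x)

      -- Divisibility supplies `c` = k b / (n + 1), which bounds the cut by `Cut-below`.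
      f-upper : ∀ {x} n k → suc n G.· x G.≤ k G.⊙ a → suc n H.· f x H.≤ k H.⊙ b
      f-upper {x} n k nx≤ka
        with c , nc≈kb ← H-divisible n (k H.⊙ b) = begin
        suc n H.· f x  ≤⟨ H.·-monoʳ-≤ (suc n) (proj₂ (proj₂ (Cut-supremum x)) c λ y y∈Cut →
          H.·-cancelˡ-≤ n (H.≤-respʳ-≈ (H.sym nc≈kb) (Cut-below n k y∈Cut nx≤ka))) ⟩
        suc n H.· c    ≈⟨ nc≈kb ⟩
        k H.⊙ b          ∎

      -- Here the same quotient `c` is itself a member of the cut.
      f-lower : ∀ {x} n k → k G.⊙ a G.≤ suc n G.· x → k H.⊙ b H.≤ suc n H.· f x
      f-lower {x} n k ka≤nx
        with c , nc≈kb ← H-divisible n (k H.⊙ b) = begin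
        k H.⊙ b          ≈⟨ nc≈kb ⟨
        suc n H.· c    ≤⟨ H.·-monoʳ-≤ (suc n)
          (proj₁ (proj₂ (Cut-supremum x)) c (n , k , ka≤nx , inj₂ nc≈kb)) ⟩
        suc n H.· f x  ∎

      f-mono-≤ : ∀ {x x′} → x G.≤ x′ → f x H.≤ f x′
      f-mono-≤ {x} {x′} x≤x′ = proj₂ (proj₂ (Cut-supremum x)) (f x′)
        λ y (n , k , ka≤nx , ny≤kb) → proj₁ (proj₂ (Cut-supremum x′)) y
          (n , k , G.≤-trans ka≤nx (G.·-monoʳ-≤ (suc n) x≤x′) , ny≤kb)

      f-cong : ∀ {x x′} → x G.≈ x′ → f x H.≈ f x′
      f-cong x≈x′ = H.≤-antisym (f-mono-≤ (inj₂ x≈x′)) (f-mono-≤ (inj₂ (G.sym x≈x′)))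

      -- Some multiple of x exceeds `a`, so 1 / (n + 1) is a fraction below x / a and b ≤ (n + 1) ·
      -- f x; this excludes f x ≤ 0.
      f-positive : ∀ {x} → G.0# G.< x → H.0# H.< f x
      f-positive {x} 0<x with H.≤-<-connex (f x) H.0#
      ... | inj₂ 0<fx = 0<fx
      ... | inj₁ fx≤0 = ⊥-elim (G.archimedean G-complete 0<x a λ (n , a<nx) →
        H.≤⇒≯ (b≤0 n (inj₁ (a<snx n a<nx))) 0<b)
        where
        a<snx : ∀ n → a G.< n G.· x → (1 , 0) G.⊙ a G.< suc n G.· x
        a<snx n a<nx = ≤G.begin-strict
          (1 , 0) G.⊙ a   ≤G.≈⟨ G.⊙-one a ⟩
          a               ≤G.<⟨ a<nx ⟩
          n G.· x         ≤G.≤⟨ G.·-monoˡ-≤ 0<x (ℕ.n≤1+n n) ⟩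
          suc n G.· x   ≤G.∎

        b≤0 : ∀ n → (1 , 0) G.⊙ a G.≤ suc n G.· x → b H.≤ H.0#
        b≤0 n a≤nx = begin
          b                 ≈⟨ H.⊙-one b ⟨
          (1 , 0) H.⊙ b     ≤⟨ f-lower n (1 , 0) a≤nx ⟩
          suc n H.· f x   ≤⟨ H.·-monoʳ-≤ (suc n) fx≤0 ⟩
          suc n H.· H.0#  ≈⟨ H.×-idem (H.+-identityˡ H.0#) (suc n) ⟩
          H.0#              ∎

      Floor : ℕ → ℕ × ℕ → G.Carrier → Set ℓ
      Floor n k x = k G.⊙ a G.≤ suc n G.· x × suc n G.· x G.< (k ⊕ (1 , 0)) G.⊙ a

      f-floor : ∀ n {x} k → Floor n k x →
                k H.⊙ b H.≤ suc n H.· f x × suc n H.· f x H.≤ (k ⊕ (1 , 0)) H.⊙ b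
      f-floor n k (ka≤nx , nx<k⁺a) = f-lower n k ka≤nx , f-upper n (k ⊕ (1 , 0)) (inj₁ nx<k⁺a)

      -- Let k and l be the integer parts of (n + 1) x / a and (n + 1) x′ / a. Both (n + 1) · f (x +
      -- x′) and (n + 1) · (f x + f x′) lie between (k + l) b and (k + l + 2) b. They differ by at
      -- most b + b for every n, and `·-bounded-gap` makes the difference vanish.
      f-homo : ∀ x x′ → f (x G.+ x′) H.≈ f x H.+ f x′
      f-homo x x′ = H.≤-antisym
        (H.·-bounded-gap H-complete λ n → gap n (λ k l kx lx′ → begin
          suc n H.· f (x G.+ x′)  ≤⟨ sum≤ n k l kx lx′ ⟩
          (k H.⊙ b H.+ b) H.+ (l H.⊙ b H.+ b)
            ≈⟨ H.interchange (k H.⊙ b) b (l H.⊙ b) b ⟩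
          (k H.⊙ b H.+ l H.⊙ b) H.+ (b H.+ b)
            ≤⟨ H.+-monoˡ-≤ (b H.+ b) (H.+-mono-≤ (proj₁ (f-floor n k kx))
                                         (proj₁ (f-floor n l lx′))) ⟩
          (suc n H.· f x H.+ suc n H.· f x′) H.+ (b H.+ b)
            ≈⟨ H.+-congʳ (H.×-distrib-+ (f x) (f x′) (suc n)) ⟨
          suc n H.· (f x H.+ f x′) H.+ (b H.+ b) ∎))
        (H.·-bounded-gap H-complete λ n → gap n (λ k l kx lx′ → begin
          suc n H.· (f x H.+ f x′)
            ≈⟨ H.×-distrib-+ (f x) (f x′) (suc n) ⟩
          suc n H.· f x H.+ suc n H.· f x′
            ≤⟨ H.+-mono-≤ (proj₂ (f-floor n k kx)) (proj₂ (f-floor n l lx′)) ⟩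
          (k ⊕ (1 , 0)) H.⊙ b H.+ (l ⊕ (1 , 0)) H.⊙ b
            ≈⟨ H.+-cong (H.⊙-next k b) (H.⊙-next l b) ⟩
          (k H.⊙ b H.+ b) H.+ (l H.⊙ b H.+ b)
            ≈⟨ H.interchange (k H.⊙ b) b (l H.⊙ b) b ⟩
          (k H.⊙ b H.+ l H.⊙ b) H.+ (b H.+ b)
            ≤⟨ H.+-monoˡ-≤ (b H.+ b) (≤sum n k l kx lx′) ⟩
          suc n H.· f (x G.+ x′) H.+ (b H.+ b) ∎))
        where
        -- Integer parts exist only up to double negation; the goal is an inequality, so they may be
        -- assumed.
        gap : ∀ n {y z} → (∀ k l → Floor n k x → Floor n l x′ → y H.≤ z) → y H.≤ z
        gap n y≤z = H.≮⇒≥ λ z<y →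
          G.floor G-complete 0<a (suc n G.· x) λ (k , kx) →
          G.floor G-complete 0<a (suc n G.· x′) λ (l , lx′) →
          H.≤⇒≯ (y≤z k l kx lx′) z<y

        sum≤ : ∀ n k l → Floor n k x → Floor n l x′ →
               suc n H.· f (x G.+ x′) H.≤ (k H.⊙ b H.+ b) H.+ (l H.⊙ b H.+ b)
        sum≤ n k l (_ , nx<k⁺a) (_ , nx′<l⁺a) = begin
          suc n H.· f (x G.+ x′)                     ≤⟨ f-upper n (k⁺ ⊕ l⁺) (≤G.begin
            suc n G.· (x G.+ x′)                ≤G.≈⟨ G.×-distrib-+ x x′ (suc n) ⟩
            suc n G.· x G.+ suc n G.· x′      ≤G.≤⟨ G.+-mono-≤ (inj₁ nx<k⁺a) (inj₁ nx′<l⁺a) ⟩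
            k⁺ G.⊙ a G.+ l⁺ G.⊙ a                 ≤G.≈⟨ G.⊙-homo-⊕ k⁺ l⁺ a ⟨
            (k⁺ ⊕ l⁺) G.⊙ a                       ≤G.∎) ⟩
          (k⁺ ⊕ l⁺) H.⊙ b                              ≈⟨ H.⊙-homo-⊕ k⁺ l⁺ b ⟩
          k⁺ H.⊙ b H.+ l⁺ H.⊙ b                        ≈⟨ H.+-cong (H.⊙-next k b) (H.⊙-next l b) ⟩
          (k H.⊙ b H.+ b) H.+ (l H.⊙ b H.+ b)          ∎
          where
          k⁺ = k ⊕ (1 , 0)
          l⁺ = l ⊕ (1 , 0)

        ≤sum : ∀ n k l → Floor n k x → Floor n l x′ →
               k H.⊙ b H.+ l H.⊙ b H.≤ suc n H.· f (x G.+ x′)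
        ≤sum n k l (ka≤nx , _) (la≤nx′ , _) = begin
          k H.⊙ b H.+ l H.⊙ b       ≈⟨ H.⊙-homo-⊕ k l b ⟨
          (k ⊕ l) H.⊙ b             ≤⟨ f-lower n (k ⊕ l) (≤G.begin
            (k ⊕ l) G.⊙ a                     ≤G.≈⟨ G.⊙-homo-⊕ k l a ⟩
            k G.⊙ a G.+ l G.⊙ a               ≤G.≤⟨ G.+-mono-≤ ka≤nx la≤nx′ ⟩
            suc n G.· x G.+ suc n G.· x′  ≤G.≈⟨ G.×-distrib-+ x x′ (suc n) ⟨
            suc n G.· (x G.+ x′)            ≤G.∎) ⟩
          suc n H.· f (x G.+ x′)  ∎

      f-split : ∀ x e → f x H.≈ f (x G.+ G.- e) H.+ f e
      f-split x e = H.trans (f-cong (G.sym (G.x-y+y≈x x e))) (f-homo (x G.+ G.- e) e)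

      f-mono-< : ∀ {x x′} → x G.< x′ → f x H.< f x′
      f-mono-< {x} {x′} x<x′ = begin-strict
        f x                               <⟨ H.x<x+y (f x) (f-positive (G.0<y-x x<x′)) ⟩
        f x H.+ f (x′ G.+ G.- x)          ≈⟨ f-homo x (x′ G.+ G.- x) ⟨
        f (x G.+ (x′ G.+ G.- x))          ≈⟨ f-cong (G.x+[y-x]≈y x x′) ⟩
        f x′                              ∎

      f-0# : f G.0# H.≈ H.0#
      f-0# = H.identityˡ-unique (f G.0#) (f G.0#)
        (H.trans (H.sym (f-homo G.0# G.0#)) (f-cong (G.+-identityˡ G.0#)))

      f-· : ∀ n x → f (n G.· x) H.≈ n H.· f x
      f-· zero      x = f-0#
      f-· (suc n) x = H.trans (f-homo x (n G.· x)) (H.+-congˡ (f-· n x))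

      -- Choose n with f a < n · d, then e with n · e < a; additivity gives n · f e < f a < n · d.
      f-small : ∀ {d} → H.0# H.< d → ¬ ¬ ∃ λ e → G.0# G.< e × f e H.< d
      f-small {d} 0<d ∄e = H.archimedean H-complete 0<d (f a) λ (n , fa<nd) →
        let e , 0<e , ne<a = G.small-multiple G-dense n 0<a
        in ∄e (e , 0<e , H.·-cancelˡ-< n (begin-strict
          n H.· f e    ≈⟨ f-· n e ⟨
          f (n G.· e)  <⟨ f-mono-< ne<a ⟩
          f a          <⟨ fa<nd ⟩
          n H.· d      ∎))

      -- The preimage is the supremum s of all x with f x ≤ y. If f s were off, an e with f e
      -- smaller than the error would make s - e an upper bound or put s + e into the set.
      f-surjective : ∀ y → ∃ λ x → f x H.≈ y
      f-surjective y = s , H.≤-antisym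
        (H.≮⇒≥ λ y<fs → f-small (H.0<y-x y<fs) λ (e , 0<e , fe<fs-y) →
          G.≤⇒≯ (least (s G.+ G.- e) (λ x fx≤y → G.≮⇒≥ λ s-e<x → H.irrefl H.refl (begin-strict
            f s                         ≈⟨ f-split s e ⟩
            f (s G.+ G.- e) H.+ f e     <⟨ H.+-monoˡ-< (f e) (f-mono-< s-e<x) ⟩
            f x H.+ f e                 ≤⟨ H.+-monoˡ-≤ (f e) fx≤y ⟩
            y H.+ f e                   <⟨ H.+-monoʳ-< y fe<fs-y ⟩
            y H.+ (f s H.+ H.- y)       ≈⟨ H.x+[y-x]≈y y (f s) ⟩
            f s                         ∎)))
            (G.x-y<x s 0<e))
        (H.≮⇒≥ λ fs<y → f-small (H.0<y-x fs<y) λ (e , 0<e , fe<y-fs) →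
          G.≤⇒≯ (upper (s G.+ e) (begin
            f (s G.+ e)                 ≈⟨ f-homo s e ⟩
            f s H.+ f e                 <⟨ H.+-monoʳ-< (f s) fe<y-fs ⟩
            f s H.+ (y H.+ H.- f s)     ≈⟨ H.x+[y-x]≈y (f s) y ⟩
            y                           ∎))
            (G.x<x+y s 0<e))
        where
        Below : Pred G.Carrier ℓ
        Below x = f x H.≤ y

        below-inhabited : ¬ ¬ ∃ Below
        below-inhabited ∄x = H.archimedean H-complete (f-positive 0<a) (H.- y) λ (n , -y<nfa) →
          ∄x (G.- (n G.· a) , H.+-cancelʳ-≤ (n H.· f a) (begin
            f (G.- (n G.· a)) H.+ n H.· f a      ≈⟨ H.+-congˡ (f-· n a) ⟨
            f (G.- (n G.· a)) H.+ f (n G.· a)    ≈⟨ f-homo (G.- (n G.· a)) (n G.· a) ⟨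
            f (G.- (n G.· a) G.+ n G.· a)        ≈⟨ f-cong (G.-‿inverseˡ (n G.· a)) ⟩
            f G.0#                               ≈⟨ f-0# ⟩
            H.0#                                 ≈⟨ H.-‿inverseʳ y ⟨
            y H.+ H.- y                          <⟨ H.+-monoʳ-< y -y<nfa ⟩
            y H.+ n H.· f a                      ∎))

        below-bounded : ¬ ¬ ∃ (G.UpperBound Below)
        below-bounded ∄b = H.archimedean H-complete (f-positive 0<a) y λ (n , y<nfa) →
          ∄b (n G.· a , λ x fx≤y → G.≮⇒≥ λ na<x → H.irrefl H.refl (begin-strict
            f x          ≤⟨ fx≤y ⟩
            y            <⟨ y<nfa ⟩
            n H.· f a    ≈⟨ f-· n a ⟨
            f (n G.· a)  <⟨ f-mono-< na<x ⟩
            f x          ∎))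

        s-sup : ∃ (G.Supremum Below)
        s-sup = G-complete Below below-inhabited below-bounded

        s = proj₁ s-sup
        upper = proj₁ (proj₂ s-sup)
        least = proj₂ (proj₂ s-sup)

    isomorphism : OrderedGroupIsomorphism G H
    isomorphism = record
      { ⟦_⟧        = f
      ; ⟦⟧-cong    = f-cong
      ; +-homo     = f-homo
      ; mono-<     = f-mono-<
      ; surjective = f-surjective
      }

-- The exponential function

module Exponential {ℓ : Level} (R : CompleteOrderedField ℓ) where

  open CompleteOrderedField R renaming (Carrier to ℝ)
  open IsCommutativeRing isCommutativeRing
    using ( refl; sym; trans; +-cong; *-cong; *-comm; *-assoc; +-identityˡ
          ; +-identityʳ; *-identityˡ; *-identityʳ; zeroˡ; zeroʳ )

  ring : CommutativeRing ℓ ℓ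
  ring = record { isCommutativeRing = isCommutativeRing }

  +-group : OrderedAbelianGroup ℓ
  +-group = record
    { isAbelianGroup     = CommutativeRing.+-isAbelianGroup ring
    ; isStrictTotalOrder = isStrictTotalOrder
    ; +-monoʳ-<          = +-monoʳ-<
    }

  private
    module + where
      open OrderedAbelianGroup +-group public
      open OrderedAbelianGroupProperties +-group public
  open + using ( compare; irrefl; <-trans; <-respʳ-≈; ≤-respˡ-≈; ≤-respʳ-≈
               ; ≤-trans; ≤-<-connex; ≮⇒≥; ≤⇒≯ )
  open IsStrictTotalOrder isStrictTotalOrder using (_≟_)
  open RingProperties (CommutativeRing.ring ring) using (-1*x≈-x; -‿involutive; x[y-z]≈xy-xz)
  open CommutativeSemigroupProperties
    (CommutativeRing.*-commutativeSemigroup ring) using (interchange)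
  open StrictReasoning (StrictTotalOrder.strictPartialOrder +.strictTotalOrder)

  -- Order and reciprocals in the field

  0<1 : 0# < 1#
  0<1 with compare 0# 1#
  ... | tri< 0<1 _ _ = 0<1
  ... | tri≈ _ 0≈1 _ = contradiction (sym 0≈1) 1≉0
  ... | tri> _ _ 1<0 = begin-strict
    0#           <⟨ *-positive 0<-1 0<-1 ⟩
    - 1# * - 1#  ≈⟨ -1*x≈-x (- 1#) ⟩
    - - 1#       ≈⟨ -‿involutive 1# ⟩
    1#           ∎
    where
    0<-1 : 0# < - 1#
    0<-1 = <-respʳ-≈ (+-identityˡ (- 1#)) (+.0<y-x 1<0)

  *-monoʳ-< : ∀ {x y z} → 0# < x → y < z → x * y < x * z
  *-monoʳ-< {x} {y} {z} 0<x y<z = begin-strict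
    x * y                      <⟨ +.x<x+y (x * y) (*-positive 0<x (+.0<y-x y<z)) ⟩
    x * y + x * (z + - y)      ≈⟨ +-cong refl (x[y-z]≈xy-xz x z y) ⟩
    x * y + (x * z + - (x * y)) ≈⟨ +.x+[y-x]≈y (x * y) (x * z) ⟩
    x * z                      ∎

  *-monoʳ-≤ : ∀ {x y z} → 0# < x → y ≤ z → x * y ≤ x * z
  *-monoʳ-≤ 0<x (inj₁ y<z) = inj₁ (*-monoʳ-< 0<x y<z)
  *-monoʳ-≤ 0<x (inj₂ y≈z) = inj₂ (*-cong refl y≈z)

  0<⇒≉0 : ∀ {x} → 0# < x → ¬ (x ≈ 0#)
  0<⇒≉0 0<x x≈0 = irrefl (sym x≈0) 0<x

  -- Extended by 1/0 = 0, which makes it a multiplicative involution of ℝ.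
  recip : ℝ → ℝ
  recip x with x ≟ 0#
  ... | yes _   = 0#
  ... | no  x≉0 = proj₁ (inverse x x≉0)

  recip-inverseʳ : ∀ {x} → ¬ (x ≈ 0#) → x * recip x ≈ 1#
  recip-inverseʳ {x} x≉0 with x ≟ 0#
  ... | yes x≈0  = contradiction x≈0 x≉0
  ... | no  x≉0′ = proj₂ (inverse x x≉0′)

  recip-zero : ∀ {x} → x ≈ 0# → recip x ≈ 0#
  recip-zero {x} x≈0 with x ≟ 0#
  ... | yes _   = refl
  ... | no  x≉0 = contradiction x≈0 x≉0

  -- Reduces identities between reciprocals of nonzero numbers to exhibiting one inverse; x y ≈ 1
  -- already forces x to be nonzero.
  recip-unique : ∀ {x y} → x * y ≈ 1# → y ≈ recip x
  recip-unique {x} {y} xy≈1 = begin-equality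
    y                  ≈⟨ *-identityˡ y ⟨
    1# * y             ≈⟨ *-cong (recip-inverseʳ x≉0) refl ⟨
    x * recip x * y    ≈⟨ *-cong (*-comm x (recip x)) refl ⟩
    recip x * x * y    ≈⟨ *-assoc (recip x) x y ⟩
    recip x * (x * y)  ≈⟨ *-cong refl xy≈1 ⟩
    recip x * 1#       ≈⟨ *-identityʳ (recip x) ⟩
    recip x            ∎
    where
    x≉0 : ¬ (x ≈ 0#)
    x≉0 x≈0 = 1≉0 (begin-equality
      1#      ≈⟨ xy≈1 ⟨
      x * y   ≈⟨ *-cong x≈0 refl ⟩
      0# * y  ≈⟨ zeroˡ y ⟩
      0#      ∎)

  recip-cong : ∀ {x y} → x ≈ y → recip x ≈ recip y
  recip-cong {x} {y} x≈y with x ≟ 0#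
  ... | yes x≈0 = sym (recip-zero (trans (sym x≈y) x≈0))
  ... | no  x≉0 = recip-unique (trans (*-cong (sym x≈y) refl) (proj₂ (inverse x x≉0)))

  recip-involutive : ∀ x → recip (recip x) ≈ x
  recip-involutive x with x ≟ 0#
  ... | yes x≈0 = trans (recip-zero refl) (sym x≈0)
  ... | no  x≉0 = sym (recip-unique (trans (*-comm _ x) (proj₂ (inverse x x≉0))))

  recip-homo : ∀ x y → recip (x * y) ≈ recip x * recip y
  recip-homo x y with x ≟ 0# | y ≟ 0#
  ... | yes x≈0 | _       =
    trans (recip-zero (trans (*-cong x≈0 refl) (zeroˡ y))) (sym (zeroˡ _))
  ... | no  _   | yes y≈0 =
    trans (recip-zero (trans (*-cong refl y≈0) (zeroʳ x))) (sym (zeroʳ _))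
  ... | no  x≉0 | no  y≉0 = sym (recip-unique (begin-equality
    x * y * (x⁻¹ * y⁻¹)    ≈⟨ interchange x y x⁻¹ y⁻¹ ⟩
    x * x⁻¹ * (y * y⁻¹)    ≈⟨ *-cong (proj₂ (inverse x x≉0)) (proj₂ (inverse y y≉0)) ⟩
    1# * 1#                ≈⟨ *-identityˡ 1# ⟩
    1#                     ∎))
    where
    x⁻¹ = proj₁ (inverse x x≉0)
    y⁻¹ = proj₁ (inverse y y≉0)

  recip-1# : recip 1# ≈ 1#
  recip-1# = sym (recip-unique (*-identityˡ 1#))

  recip-positive : ∀ {x} → 0# < x → 0# < recip x
  recip-positive {x} 0<x with ≤-<-connex (recip x) 0#
  ... | inj₂ 0<recip = 0<recip
  ... | inj₁ recip≤0 = contradiction 0<1 (≤⇒≯ (begin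
    1#           ≈⟨ recip-inverseʳ (0<⇒≉0 0<x) ⟨
    x * recip x  ≤⟨ *-monoʳ-≤ 0<x recip≤0 ⟩
    x * 0#       ≈⟨ zeroʳ x ⟩
    0#           ∎))

  -- The positive reals under multiplication

  *-group : OrderedAbelianGroup ℓ
  *-group = record
    { Carrier            = Σ ℝ (0# <_)
    ; _≈_                = λ (x , _) (y , _) → x ≈ y
    ; _<_                = λ (x , _) (y , _) → x < y
    ; _+_                = λ (x , 0<x) (y , 0<y) → x * y , *-positive 0<x 0<y
    ; 0#                 = 1# , 0<1
    ; -_                 = λ (x , 0<x) → recip x , recip-positive 0<x
    ; isAbelianGroup     = record
      { isGroup = record
        { isMonoid = record
          { isSemigroup = record
            { isMagma = record
              { isEquivalence = On.isEquivalence proj₁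
                  (IsCommutativeRing.isEquivalence isCommutativeRing)
              ; ∙-cong        = *-cong
              }
            ; assoc = λ (x , _) (y , _) (z , _) → *-assoc x y z
            }
          ; identity = (λ (x , _) → *-identityˡ x) , (λ (x , _) → *-identityʳ x)
          }
        ; inverse = (λ (x , 0<x) → trans (*-comm (recip x) x) (recip-inverseʳ (0<⇒≉0 0<x)))
                  , (λ (x , 0<x) → recip-inverseʳ (0<⇒≉0 0<x))
        ; ⁻¹-cong = recip-cong
        }
      ; comm = λ (x , _) (y , _) → *-comm x y
      }
    ; isStrictTotalOrder = On.isStrictTotalOrder proj₁ isStrictTotalOrder
    ; +-monoʳ-<          = λ (x , 0<x) → *-monoʳ-< 0<x
    }

  private
    module * where
      open OrderedAbelianGroup *-group public
      open OrderedAbelianGroupProperties *-group public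

  -- Negation reverses the order in every ordered abelian group, and in `*-group` negation is
  -- `recip`.
  recip-anti-< : ∀ {x y} → 0# < x → 0# < y → x < y → recip y < recip x
  recip-anti-< 0<x 0<y = *.-‿anti-< {_ , 0<x} {_ , 0<y}

  recip-anti-≤ : ∀ {x y} → 0# < x → 0# < y → x ≤ y → recip y ≤ recip x
  recip-anti-≤ 0<x 0<y = *.-‿anti-≤ {_ , 0<x} {_ , 0<y}

  -- Divisibility, density and completeness

  +-divisible : +.Divisible
  +-divisible n x = recip N * x , (begin-equality
    suc n +.· (recip N * x)         ≈⟨ +.×-congʳ (suc n) (*-identityˡ (recip N * x)) ⟨
    suc n +.· (1# * (recip N * x))  ≈⟨ ×-assoc-* (suc n) 1# (recip N * x) ⟨
    N * (recip N * x)                 ≈⟨ *-assoc N (recip N) x ⟨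
    N * recip N * x                   ≈⟨ *-cong (recip-inverseʳ (0<⇒≉0 (+.0<sn·x n 0<1))) refl ⟩
    1# * x                            ≈⟨ *-identityˡ x ⟩
    x                                 ∎)
    where
    open SemiringMult (CommutativeRing.semiring ring) using (×-assoc-*)
    N = suc n +.· 1#

  *-dense : *.Dense
  *-dense (x , 0<x) 1<x = (m , <-trans 0<1 1<m) , 1<m , m<x
    where
    midpoint = +-divisible 1 (1# + x)
    m = proj₁ midpoint

    1<m : 1# < m
    1<m = +.·-cancelˡ-< 2 (begin-strict
      1# + (1# + 0#)  ≈⟨ +-cong refl (+-identityʳ 1#) ⟩
      1# + 1#         <⟨ +-monoʳ-< 1# 1<x ⟩
      1# + x          ≈⟨ proj₂ midpoint ⟨
      2 +.· m         ∎)

    m<x : m < x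
    m<x = +.·-cancelˡ-< 2 (begin-strict
      2 +.· m         ≈⟨ proj₂ midpoint ⟩
      1# + x          <⟨ +.+-monoˡ-< x 1<x ⟩
      x + x           ≈⟨ +-cong refl (+-identityʳ x) ⟨
      x + (x + 0#)    ∎)

  -- `supremum` needs an explicit bound.  Whatever P is, the set of u ≤ 1 with
  -- u ≤ 1/p for all positive p in P has one; the double negation suffices for its
  -- supremum s to be positive, and then 1/s bounds P.
  upperBound : ∀ P → ¬ ¬ ∃ (UpperBound P) → ∃ (UpperBound P)
  upperBound P ¬∄b = recip s , bound
    where
    Lower : Pred ℝ ℓ
    Lower u = u ≤ 1# × (∀ p → p ∈ P → 0# < p → u ≤ recip p)

    s-sup : ∃ λ s → UpperBound Lower s × (∀ b → UpperBound Lower b → s ≤ b)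
    s-sup = supremum Lower
      (0# , inj₁ 0<1 , λ p _ 0<p → inj₁ (recip-positive 0<p)) (1# , λ _ → proj₁)

    s = proj₁ s-sup
    upper = proj₁ (proj₂ s-sup)
    least = proj₂ (proj₂ s-sup)

    positive-lower : ∀ b → UpperBound P b → ∃ λ u → 0# < u × u ∈ Lower
    -- For positive b the witness is the smaller of 1 and 1/b; a b that is not positive falls under
    -- the first case, with witness 1.
    positive-lower b b-upper with ≤-<-connex b 1#
    ... | inj₁ b≤1 = 1# , 0<1 , inj₂ refl , λ p p∈P 0<p →
      ≤-respˡ-≈ recip-1# (recip-anti-≤ 0<p 0<1 (≤-trans (b-upper p p∈P) b≤1))
    ... | inj₂ 1<b = recip b , recip-positive 0<b
      , ≤-respʳ-≈ recip-1# (recip-anti-≤ 0<1 0<b (inj₁ 1<b))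
      , λ p p∈P 0<p → recip-anti-≤ 0<p 0<b (b-upper p p∈P)
      where
      0<b : 0# < b
      0<b = <-trans 0<1 1<b

    0<s : 0# < s
    0<s with ≤-<-connex s 0#
    ... | inj₂ 0<s = 0<s
    ... | inj₁ s≤0 = ⊥-elim (¬∄b λ (b , b-upper) →
      let u , 0<u , u∈Lower = positive-lower b b-upper
      in ≤⇒≯ (≤-trans (upper u u∈Lower) s≤0) 0<u)

    bound : UpperBound P (recip s)
    bound p p∈P with ≤-<-connex p 0#
    ... | inj₁ p≤0 = ≤-trans p≤0 (inj₁ (recip-positive 0<s))
    -- 1/p bounds `Lower`, so s ≤ 1/p; taking reciprocals gives p ≤ 1/s.
    ... | inj₂ 0<p = ≤-respˡ-≈ (recip-involutive p)
      (recip-anti-≤ 0<s (recip-positive 0<p)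
        (least (recip p) λ u u∈Lower → proj₂ u∈Lower p p∈P 0<p))

  +-complete : +.Complete
  +-complete P ¬∄x ¬∄b = s , (λ x x∈P → upper x (inj₁ x∈P)) , s-least
    where
    -- m bounds the negated lower bounds of P, so l is not a lower bound of P and
    -- adjoining it to P does not change the upper bounds.
    m-bound : ∃ (UpperBound λ n → UpperBound P (- n))
    m-bound = upperBound (λ n → UpperBound P (- n)) λ ∄b →
      ¬∄x λ (x , x∈P) → ∄b (- x , λ n -n-upper → +.x≤-y⇒y≤-x (-n-upper x x∈P))

    m = proj₁ m-bound
    l = - (m + 1#)

    -- If no element of `P` exceeded `l`, then `l` would be an upper bound of `P`, and m + 1 would
    -- be one of the numbers that `m` bounds.
    l-below : ¬ ¬ ∃ λ x → x ∈ P × l < x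
    l-below ∄x = ≤⇒≯ (proj₂ m-bound (m + 1#) λ x x∈P → ≮⇒≥ λ l<x → ∄x (x , x∈P , l<x))
      (+.x<x+y m 0<1)

    P∪l : Pred ℝ ℓ
    P∪l x = x ∈ P ⊎ x ≈ l

    P∪l-upper : ∀ b → UpperBound P b → UpperBound P∪l b
    P∪l-upper b b-upper x (inj₁ x∈P) = b-upper x x∈P
    P∪l-upper b b-upper x (inj₂ x≈l) = ≤-respˡ-≈ (sym x≈l) (≮⇒≥ λ b<l →
      l-below λ (y , y∈P , l<y) → ≤⇒≯ (b-upper y y∈P) (<-trans b<l l<y))

    s-sup : ∃ λ s → UpperBound P∪l s × (∀ b → UpperBound P∪l b → s ≤ b)
    s-sup = supremum P∪l (l , inj₂ refl)
      (let b , b-upper = upperBound P ¬∄b in b , P∪l-upper b b-upper)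

    s = proj₁ s-sup
    upper = proj₁ (proj₂ s-sup)

    s-least : ∀ b → UpperBound P b → s ≤ b
    s-least b b-upper = proj₂ (proj₂ s-sup) b (P∪l-upper b b-upper)

  *-complete : *.Complete
  *-complete P ¬∄x ¬∄b = (s , 0<s)
    , (λ (x , 0<x) x∈P → upper x (0<x , x∈P))
    , (λ (b , _) b-upper → least b λ x (0<x , x∈P) → b-upper (x , 0<x) x∈P)
    where
    P′ : Pred ℝ ℓ
    P′ x = Σ (0# < x) λ 0<x → (x , 0<x) ∈ P

    s-sup : ∃ (+.Supremum P′)
    s-sup = +-complete P′
      (λ ∄x → ¬∄x λ ((x , 0<x) , x∈P) → ∄x (x , 0<x , x∈P))
      (λ ∄b → ¬∄b λ ((b , _) , b-upper) → ∄b (b , λ x (0<x , x∈P) → b-upper (x , 0<x) x∈P))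

    s = proj₁ s-sup
    upper = proj₁ (proj₂ s-sup)
    least = proj₂ (proj₂ s-sup)

    -- s lies above every member of `P`, and these are positive. A member is available only under
    -- double negation, but the sign of s is decidable.
    0<s : 0# < s
    0<s with ≤-<-connex s 0#
    ... | inj₂ 0<s = 0<s
    ... | inj₁ s≤0 = ⊥-elim (¬∄x λ ((x , 0<x) , x∈P) →
      ≤⇒≯ (≤-trans (upper x (0<x , x∈P)) s≤0) 0<x)

  -- Exponential and logarithm

  1<2 : 1# < 1# + 1#
  1<2 = +.x<x+y 1# 0<1

  abstract
    -- Sending 2 to 1 makes the inverted map the logarithm to base 2, so `exp` is x ↦ 2^x; any
    -- number above 1 could serve as base.
    exp-iso : OrderedGroupIsomorphism +-group *-group
    exp-iso = inverseIsomorphism (Hölder.isomorphism *-group +-group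
      *-complete *-dense +-complete +-divisible
      {1# + 1# , <-trans 0<1 1<2} {1#} 1<2 0<1)

  open OrderedGroupIsomorphism exp-iso public using ()
    renaming ( ⟦⟧-cong to exp-cong; +-homo to exp-homo; mono-< to exp-mono-<
             ; mono-≤ to exp-mono-≤; cancel-< to exp-cancel-<; cancel-≤ to exp-cancel-≤
             ; injective to exp-injective; 0#-homo to exp-0#)

  exp : ℝ → ℝ
  exp x = proj₁ (OrderedGroupIsomorphism.⟦_⟧ exp-iso x)

  exp-positive : ∀ x → 0# < exp x
  exp-positive x = proj₂ (OrderedGroupIsomorphism.⟦_⟧ exp-iso x)

  log : ∀ {y} → 0# < y → ℝ
  log 0<y = proj₁ (OrderedGroupIsomorphism.surjective exp-iso (_ , 0<y))

  exp-log : ∀ {y} (0<y : 0# < y) → exp (log 0<y) ≈ y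
  exp-log 0<y = proj₂ (OrderedGroupIsomorphism.surjective exp-iso (_ , 0<y))

-- Arithmetic functions

module FunctionIsomorphisms {ℓ : Level} (R : CompleteOrderedField ℓ) where

  open CompleteOrderedField R renaming (Carrier to ℝ)
  open IsCommutativeRing isCommutativeRing using (refl; sym; trans; *-cong; *-comm; zeroʳ)
  open ArithmeticFunctions R
  open Exponential R
  open OrderedAbelianGroupProperties +-group
    using ( irrefl; <-trans; <-respˡ-≈; <-respʳ-≈; ≤-respˡ-≈; ≤-respʳ-≈
          ; ≤-<-connex; ≤⇒≯ )

  -- `cong`, `injective` and `homo` range over all of ℝ because `carries` speaks of arbitrary
  -- arithmetic functions, which may take the value 0 or negative values. This is what the
  -- convention 1/0 = 0 is for: it keeps `recip` injective and multiplicative everywhere.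
  -- Surjectivity is asked only for members, since `exp` misses the nonpositive reals.
  record PointwiseIsomorphism (S T : FunctionSemigroup) : Set ℓ where
    private
      module S = FunctionSemigroup S
      module T = FunctionSemigroup T
    field
      φ         : ℝ → ℝ
      cong      : ∀ {x y} → x ≈ y → φ x ≈ φ y
      injective : ∀ {x y} → φ x ≈ φ y → x ≈ y
      homo      : ∀ x y → φ (x S.∙ y) ≈ φ x T.∙ φ y
      image     : ∀ {f} → f ∈ S.Member → φ ∘ f ∈ T.Member
      preimage  : ∀ {g} → g ∈ T.Member → ∃ λ f → f ∈ S.Member × (∀ x → φ (f x) ≈ g x)

    equationTransfer : EquationTransfer S T
    equationTransfer = record
      { Φ       = φ ∘_
      ; mapsTo  = image
      ; carries = λ f x y _ → mk⇔
          (λ f-splits → trans (cong f-splits) (homo (f x) (f y)))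
          (λ φf-splits → injective (trans φf-splits (sym (homo (f x) (f y)))))
      }

    semigroupIsomorphism : S ≅ˢ T
    semigroupIsomorphism = equationTransfer , record
      { isMagmaMonomorphism = record
        { isMagmaHomomorphism = record
          { isRelHomomorphism = record { cong = λ f≈g x → cong (f≈g x) }
          ; homo              = λ f g x → homo (proj₁ f x) (proj₁ g x)
          }
        ; injective = λ φf≈φg x → injective (φf≈φg x)
        }
      ; surjective = λ (g , g∈T) → let f , f∈S , φf≈g = preimage g∈T in
          (f , f∈S) , λ h≈f x → trans (cong (h≈f x)) (φf≈g x)
      }

  monoidIsomorphism : ∀ S T →
    PointwiseIsomorphism (FunctionMonoid.functionSemigroup S)
                         (FunctionMonoid.functionSemigroup T) → S ≅ᵐ T
  monoidIsomorphism S T ι = equationTransfer , record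
    { isMonoidMonomorphism = record
      { isMonoidHomomorphism = record
        { isMagmaHomomorphism = isMagmaHomomorphism
        ; ε-homo              = λ _ → ε-homo
        }
      ; injective = λ φf≈φg x → injective (φf≈φg x)
      }
    ; surjective = surjective
    }
    where
    module S = FunctionMonoid S
    module T = FunctionMonoid T
    open PointwiseIsomorphism ι
    open MagmaMorphisms.IsMagmaIsomorphism (proj₂ semigroupIsomorphism)
      using (isMagmaHomomorphism; surjective)
    open IsCommutativeSemigroup T.isCommutativeSemigroup using (∙-cong)

    -- Surjectivity replaces cancellation. With φ r ≈ ε, one has φ ε ≈ φ ε ∙ φ r ≈ φ (ε ∙ r) ≈ φ r ≈
    -- ε. The point `2⁺` merely picks a real r out of a preimage of the constant function.
    ε-homo : φ S.ε ≈ T.ε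
    ε-homo =
      let e , _ , φe≈ε = preimage T.ε-member
          r = e 2⁺
      in trans (sym (proj₂ T.identity (φ S.ε)))
          (trans (∙-cong refl (sym (φe≈ε 2⁺)))
          (trans (sym (homo S.ε r))
          (trans (cong (proj₁ S.identity r)) (φe≈ε 2⁺))))

  _⨾_ : ∀ {S T U} → PointwiseIsomorphism S T → PointwiseIsomorphism T U →
        PointwiseIsomorphism S U
  ι ⨾ κ = record
    { φ         = κ.φ ∘ ι.φ
    ; cong      = κ.cong ∘ ι.cong
    ; injective = ι.injective ∘ κ.injective
    ; homo      = λ x y → trans (κ.cong (ι.homo x y)) (κ.homo (ι.φ x) (ι.φ y))
    ; image     = κ.image ∘ ι.image
    ; preimage  = λ h∈U →
        let g , g∈T , κg≈h = κ.preimage h∈U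
            f , f∈S , ιf≈g = ι.preimage g∈T
        in f , f∈S , λ x → trans (κ.cong (ιf≈g x)) (κg≈h x)
    }
    where
    module ι = PointwiseIsomorphism ι
    module κ = PointwiseIsomorphism κ

  -- Transport of the function classes

  1<2⁺ : 1 ℕ.< value 2⁺
  1<2⁺ = s≤s (s≤s z≤n)

  -- The bounds defining the classes say nothing about the argument 1. There g 2 ≈ g 1 * g 2 with g
  -- 2 positive forces g 1 to be positive.
  multiplicative-positive : ∀ {g} → g ∈ Multiplicative → Above1 (0# <_) g → ∀ x → 0# < g x
  multiplicative-positive {g} (_ , g-mul) g>0 (suc zero , p) with ≤-<-connex (g (1 , p)) 0#
  ... | inj₂ 0<g1 = 0<g1
  ... | inj₁ g1≤0 = contradiction (g>0 2⁺ 1<2⁺) (≤⇒≯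
    (≤-respˡ-≈ (sym (trans (g-mul (1 , p) 2⁺ (1-coprimeTo 2)) (*-comm _ _)))
      (≤-respʳ-≈ (zeroʳ (g 2⁺)) (*-monoʳ-≤ (g>0 2⁺ 1<2⁺) g1≤0))))
  multiplicative-positive _ g>0 (suc (suc n) , p) = g>0 (suc (suc n) , p) (s≤s (s≤s z≤n))

  ℳ-positive : ∀ {g} → g ∈ ℳ → ∀ x → 0# < g x
  ℳ-positive (g-mul , g≥1) = multiplicative-positive g-mul λ x 1<x → ≥1⇒>0 (g≥1 x 1<x)
    where
    ≥1⇒>0 : ∀ {r} → 1# ≤ r → 0# < r
    ≥1⇒>0 (inj₁ 1<r) = <-trans 0<1 1<r
    ≥1⇒>0 (inj₂ 1≈r) = <-respʳ-≈ 1≈r 0<1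

  exp-ℳ : ∀ {f} → f ∈ 𝒜 → exp ∘ f ∈ ℳ
  exp-ℳ {f} (f-add , f≥0) =
    ( (λ exp≈0 → irrefl (sym (exp≈0 2⁺)) (exp-positive (f 2⁺)))
    , λ x y x⊥y → trans (exp-cong (f-add x y x⊥y)) (exp-homo (f x) (f y)) )
    , λ x 1<x → ≤-respˡ-≈ exp-0# (exp-mono-≤ (f≥0 x 1<x))

  -- Both properties are checked after applying `exp`, which is injective and reflects the order.
  log-𝒜 : ∀ {g} (g∈ℳ : g ∈ ℳ) → (λ x → log (ℳ-positive g∈ℳ x)) ∈ 𝒜
  log-𝒜 g∈ℳ@((_ , g-mul) , g≥1) =
    (λ x y x⊥y → exp-injective (trans (exp-log _) (trans (g-mul x y x⊥y)
      (sym (trans (exp-homo _ _) (*-cong (exp-log _) (exp-log _)))))))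
    , λ x 1<x → exp-cancel-≤ (≤-respˡ-≈ (sym exp-0#)
        (≤-respʳ-≈ (sym (exp-log _)) (g≥1 x 1<x)))

  𝒜≅ℳ : PointwiseIsomorphism
           (FunctionMonoid.functionSemigroup 𝒜-+) (FunctionMonoid.functionSemigroup ℳ-*)
  𝒜≅ℳ = record
    { φ         = exp
    ; cong      = exp-cong
    ; injective = exp-injective
    ; homo      = exp-homo
    ; image     = exp-ℳ
    ; preimage  = λ g∈ℳ → _ , log-𝒜 g∈ℳ , λ x → exp-log (ℳ-positive g∈ℳ x)
    }

  𝒜₀≅ℳ₁ : PointwiseIsomorphism 𝒜₀-+ ℳ₁-*
  𝒜₀≅ℳ₁ = record
    { φ         = exp
    ; cong      = exp-cong
    ; injective = exp-injective
    ; homo      = exp-homo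
    ; image     = λ (f∈𝒜 , f>0) → exp-ℳ f∈𝒜
        , λ x 1<x → <-respˡ-≈ exp-0# (exp-mono-< (f>0 x 1<x))
    ; preimage  = λ (g∈ℳ , g>1) → _
        , ( log-𝒜 g∈ℳ
          , λ x 1<x → exp-cancel-< (<-respˡ-≈ (sym exp-0#)
              (<-respʳ-≈ (sym (exp-log _)) (g>1 x 1<x))) )
        , λ x → exp-log (ℳ-positive g∈ℳ x)
    }

  recip-injective : ∀ {x y} → recip x ≈ recip y → x ≈ y
  recip-injective {x} {y} x⁻¹≈y⁻¹ =
    trans (sym (recip-involutive x)) (trans (recip-cong x⁻¹≈y⁻¹) (recip-involutive y))

  recip-multiplicative : ∀ {g} → g ∈ Multiplicative → 0# < g 2⁺ → recip ∘ g ∈ Multiplicative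
  recip-multiplicative {g} (_ , g-mul) 0<g2 =
    (λ recip≈0 → irrefl (sym (recip≈0 2⁺)) (recip-positive 0<g2))
    , λ x y x⊥y → trans (recip-cong (g-mul x y x⊥y)) (recip-homo (g x) (g y))

  recip-≥1 : ∀ {r} → 0# < r → r ≤ 1# → 1# ≤ recip r
  recip-≥1 0<r r≤1 = ≤-respˡ-≈ recip-1# (recip-anti-≤ 0<r 0<1 r≤1)

  recip->1 : ∀ {r} → 0# < r → r < 1# → 1# < recip r
  recip->1 0<r r<1 = <-respˡ-≈ recip-1# (recip-anti-< 0<r 0<1 r<1)

  ℳ≅ℐ₀ : PointwiseIsomorphism
            (FunctionMonoid.functionSemigroup ℳ-*) (FunctionMonoid.functionSemigroup ℐ₀-*)
  ℳ≅ℐ₀ = record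
    { φ         = recip
    ; cong      = recip-cong
    ; injective = recip-injective
    ; homo      = recip-homo
    ; image     = λ g∈ℳ@(g-mul , g≥1) → recip-multiplicative g-mul (ℳ-positive g∈ℳ 2⁺)
        , λ x 1<x → recip-positive (ℳ-positive g∈ℳ x)
        , ≤-respʳ-≈ recip-1# (recip-anti-≤ 0<1 (ℳ-positive g∈ℳ x) (g≥1 x 1<x))
    ; preimage  = λ {h} (h-mul , h-bd) → recip ∘ h
        , ( recip-multiplicative h-mul (proj₁ (h-bd 2⁺ 1<2⁺))
          , λ x 1<x → let 0<hx , hx≤1 = h-bd x 1<x in recip-≥1 0<hx hx≤1 )
        , λ x → recip-involutive (h x)
    }

  ℳ₁≅ℐ₀₁ : PointwiseIsomorphism ℳ₁-* ℐ₀₁-*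
  ℳ₁≅ℐ₀₁ = record
    { φ         = recip
    ; cong      = recip-cong
    ; injective = recip-injective
    ; homo      = recip-homo
    ; image     = λ (g∈ℳ , g>1) → recip-multiplicative (proj₁ g∈ℳ) (ℳ-positive g∈ℳ 2⁺)
        , λ x 1<x → recip-positive (ℳ-positive g∈ℳ x)
        , <-respʳ-≈ recip-1# (recip-anti-< 0<1 (ℳ-positive g∈ℳ x) (g>1 x 1<x))
    ; preimage  = λ {h} (h-mul , h-bd) → recip ∘ h
        , ( ( recip-multiplicative h-mul (proj₁ (h-bd 2⁺ 1<2⁺))
            , λ x 1<x → let 0<hx , hx<1 = h-bd x 1<x in recip-≥1 0<hx (inj₁ hx<1) )
          , λ x 1<x → let 0<hx , hx<1 = h-bd x 1<x in recip->1 0<hx hx<1 )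
        , λ x → recip-involutive (h x)
    }

proposition3p5 : ∀ {ℓ : Level} (R : CompleteOrderedField ℓ) →
    let open ArithmeticFunctions R in
    (𝒜-+ ≅ᵐ ℳ-* × 𝒜-+ ≅ᵐ ℐ₀-* × ℳ-* ≅ᵐ ℐ₀-*) ×
    (𝒜₀-+ ≅ˢ ℳ₁-* × 𝒜₀-+ ≅ˢ ℐ₀₁-* × ℳ₁-* ≅ˢ ℐ₀₁-*)
proposition3p5 R =
  ( monoidIsomorphism 𝒜-+ ℳ-* 𝒜≅ℳ
  -- The composite acts on values by r ↦ 1 / 2^r.
  , monoidIsomorphism 𝒜-+ ℐ₀-* (𝒜≅ℳ ⨾ ℳ≅ℐ₀)
  , monoidIsomorphism ℳ-* ℐ₀-* ℳ≅ℐ₀ ) ,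
  ( semigroupIsomorphism 𝒜₀≅ℳ₁
  , semigroupIsomorphism (𝒜₀≅ℳ₁ ⨾ ℳ₁≅ℐ₀₁)
  , semigroupIsomorphism ℳ₁≅ℐ₀₁ )
  where
  open ArithmeticFunctions R
  open FunctionIsomorphisms R
  open PointwiseIsomorphism using (semigroupIsomorphism)
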